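{- For every nonnegative integer $n$, $$s_B(n)=\sum_{T\in\mathcal{PT}_B(n)}\mathrm{sign}_B(T)=\begin{cases}2^{n/2}, & n \text{ even},\\ 0, & n\text{ odd}.\end{cases}$$
   Context: Let $F$ be a Ferrers diagram (left-justified rows of weakly decreasing lengths) in which both empty rows and empty columns are allowed, with $k$ columns; its length $n$ is its number of rows plus columns. Label the $n$ steps of its south-east boundary $1,\dots,n$ from north-east to south-west; a row gets label $i$ if its right-end vertical boundary step is labeled $i$, a column gets label $j$ if its bottom horizontal boundary step is labeled $j$. The shifted diagram $\bar F$ is obtained by adding on top of $F$ $k$ new left-justified rows of lengths $1,2,\dots,k$ (from top to bottom); the rightmost cell of each added row is a diagonal cell, and an added row whose rightmost cell lies in column $j$ is labeled $-j$; other labels are as in $F$. The length of $\bar F$ is $n$. A type $B$ permutation tableau of length $n$ is a $0,1$-filling of such $\bar F$ such that (1) each column contains a $1$; (2) no $0$ has both a $1$ above it in its column and a $1$ to its left in its row; (3) a $0$ in a diagonal cell has no $1$ to its left in its row. $\mathcal{PT}_B(n)$ is the set of these. A $0$ not in a diagonal cell is row-restricted if it has a $1$ above it in its column (a $0$ in a diagonal cell is never row-restricted); a $0$ is column-restricted if it has a $1$ to its left in its row. $\mathrm{URR}_B(T)$ is the set of positive row labels $i$ such that row $i$ contains no row-restricted $0$ and contains at least one $1$; $\mathrm{URC}_B(T)$ is the set of column labels $j$ such that column $j$ contains no column-restricted $0$ and row $-j$ contains no row-restricted $0$. $\mathrm{ur}_B(T)=|\mathrm{URR}_B(T)\cup\mathrm{URC}_B(T)|$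 and $\mathrm{sign}_B(T)=(-1)^{\mathrm{ur}_B(T)}$. -}

module Defs where

open import Data.Bool using (Bool; true; false; not; _∧_; _∨_; if_then_else_)
open import Data.Nat using (ℕ; zero; suc; _<ᵇ_; _≤ᵇ_; _≡ᵇ_)
open import Data.Fin using (Fin; toℕ)
open import Data.List using (List; []; _∷_; [_]; map; concatMap; _++_; foldr; filterᵇ; length; allFin)
open import Data.Bool.ListAction using (any; all)
open import Data.Vec using (Vec; []; _∷_; lookup)
open import Data.Integer using (ℤ; +_; -1ℤ; _^_) renaming (_+_ to _+ℤ_)

-- A Ferrers diagram of length n (empty rows/columns allowed) is encoded by
-- its south-east boundary path of n steps, read from north-east to south-west:
-- step with label (toℕ i + 1) is  true = vertical (right end of a row labelled i),
-- false = horizontal (bottom of a column labelled i).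
-- Row i has a cell in column j  iff  i < j (i vertical, j horizontal).
Shape : ℕ → Set
Shape n = Vec Bool n

isRow isCol : ∀ {n} → Shape n → Fin n → Bool
isRow s i = lookup s i
isCol s i = not (lookup s i)

-- Rows of the shifted diagram: negative rows (-j, j a column label) and
-- positive rows (i, i a row label of F).
data RowLab (n : ℕ) : Set where
  neg : Fin n → RowLab n
  pos : Fin n → RowLab n

allRows : (n : ℕ) → List (RowLab n)
allRows n = map neg (allFin n) ++ map pos (allFin n)

-- cells of the shifted diagram: (i , c) with i < c in F;
-- (-j , c) with j ≤ c (row -j consists of the columns weakly left of column j,
-- i.e. those with label ≥ j; its rightmost cell (-j , j) is diagonal).
isCell : ∀ {n} → Shape n → RowLab n → Fin n → Bool
isCell s (pos i) c = isRow s i ∧ isCol s c ∧ (toℕ i <ᵇ toℕ c)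
isCell s (neg j) c = isCol s j ∧ isCol s c ∧ (toℕ j ≤ᵇ toℕ c)

isDiag : ∀ {n} → RowLab n → Fin n → Bool
isDiag (pos i) c = false
isDiag (neg j) c = toℕ j ≡ᵇ toℕ c

-- rows top to bottom are in increasing order of signed label: -k < ... < -1 < 1 < ...
rowAbove : ∀ {n} → RowLab n → RowLab n → Bool
rowAbove (neg j') (neg j) = toℕ j <ᵇ toℕ j'
rowAbove (neg j') (pos i) = true
rowAbove (pos i') (neg j) = false
rowAbove (pos i') (pos i) = toℕ i' <ᵇ toℕ i

-- columns left to right are in decreasing label order: c' is left of c iff c < c'
colLeft : ∀ {n} → Fin n → Fin n → Bool
colLeft c' c = toℕ c <ᵇ toℕ c'

record Filling (n : ℕ) : Set where
  constructor mkFilling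
  field
    shape : Shape n
    P     : Vec (Vec Bool n) n
    N     : Vec (Vec Bool n) n

module _ {n : ℕ} (T : Filling n) where
  open Filling T

  entry : RowLab n → Fin n → Bool
  entry (pos i) c = lookup (lookup P i) c
  entry (neg j) c = lookup (lookup N j) c

  one : RowLab n → Fin n → Bool
  one r c = isCell shape r c ∧ entry r c

  zero' : RowLab n → Fin n → Bool
  zero' r c = isCell shape r c ∧ not (entry r c)

  oneAbove : RowLab n → Fin n → Bool
  oneAbove r c = any (λ r' → rowAbove r' r ∧ one r' c) (allRows n)

  oneLeft : RowLab n → Fin n → Bool
  oneLeft r c = any (λ c' → colLeft c' c ∧ one r c') (allFin n)

  -- entries outside the diagram are fixed to 0 (so fillings of the diagram
  -- correspond bijectively to fillings satisfying this)
  outsideZero : Bool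
  outsideZero = all (λ r → all (λ c → isCell shape r c ∨ not (entry r c)) (allFin n)) (allRows n)

  cond1 : Bool
  cond1 = all (λ c → not (isCol shape c) ∨ any (λ r → one r c) (allRows n)) (allFin n)

  cond2 : Bool
  cond2 = all (λ r → all (λ c → not (zero' r c ∧ oneAbove r c ∧ oneLeft r c)) (allFin n)) (allRows n)

  cond3 : Bool
  cond3 = all (λ r → all (λ c → not (zero' r c ∧ isDiag r c ∧ oneLeft r c)) (allFin n)) (allRows n)

  isPTB : Bool
  isPTB = outsideZero ∧ cond1 ∧ cond2 ∧ cond3

  rowRestricted : RowLab n → Fin n → Bool
  rowRestricted r c = zero' r c ∧ not (isDiag r c) ∧ oneAbove r c

  colRestricted : RowLab n → Fin n → Bool
  colRestricted r c = zero' r c ∧ oneLeft r c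

  noRowRestricted : RowLab n → Bool
  noRowRestricted r = all (λ c → not (rowRestricted r c)) (allFin n)

  inURR : Fin n → Bool
  inURR i = isRow shape i ∧ noRowRestricted (pos i) ∧ any (λ c → one (pos i) c) (allFin n)

  inURC : Fin n → Bool
  inURC j = isCol shape j
          ∧ all (λ r → not (colRestricted r j)) (allRows n)
          ∧ noRowRestricted (neg j)

  urB : ℕ
  urB = length (filterᵇ (λ ℓ → inURR ℓ ∨ inURC ℓ) (allFin n))

  signB : ℤ
  signB = -1ℤ ^ urB

allVecs : ∀ {A : Set} → List A → (m : ℕ) → List (Vec A m)
allVecs xs zero    = [ [] ]
allVecs xs (suc m) = concatMap (λ x → map (x ∷_) (allVecs xs m)) xs

bools : List Bool
bools = true ∷ false ∷ []

allFillings : (n : ℕ) → List (Filling n)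
allFillings n =
  concatMap (λ s → concatMap (λ P → map (λ N → mkFilling s P N)
                                         (allVecs (allVecs bools n) n))
                             (allVecs (allVecs bools n) n))
            (allVecs bools n)

sumℤ : List ℤ → ℤ
sumℤ = foldr _+ℤ_ (+ 0)

sB : ℕ → ℤ
sB n = sumℤ (map signB (filterᵇ (λ T → isPTB T) (allFillings n)))

{-# OPTIONS --safe #-}
-- The label n + 1 of a tableau of length n + 1 is either an empty bottom row,
-- which changes nothing, or a new leftmost column, whose 1s lie in its diagonal
-- cell or in free rows: rows without a 0 that is diagonal or has a 1 above it.
-- Fix a tableau T of length n and let r be its lowest free row. Among the ways to
-- add a column to T, changing the entry in row r reverses the sign as soon as the
-- column has another 1, which then lies above r; what survives is the column whose
-- only 1 is in row r.
-- If the last label of T is a row, r is that row and the survivor contributes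
-- sign T: both r and the new column become unrestricted. If the last label of T is
-- a column, r carries the lowest 1 of that column and the survivor contributes
-- - sign T. So the one-label extensions of T add up to 2 sign T or to 0, and over two
-- labels s_B(n + 2) = 2 s_B(n), starting from s_B(0) = 1 and s_B(1) = 0.
module Submission where

open import Defs
open import Data.Nat using (ℕ; zero; suc; _*_; _^_; _<_; _≤_; _<ᵇ_; _≤ᵇ_; _≡ᵇ_)
import Data.Nat.Properties as ℕ
open import Data.Integer using (ℤ; +_; -_; -1ℤ) renaming (_+_ to _+ℤ_; _^_ to _^ℤ_)
import Data.Integer.Properties as ℤ
open import Data.Bool using (Bool; true; false; not; _∧_; _∨_; if_then_else_)
open import Data.Bool.ListAction using (any; all)
open import Data.Bool.Properties using (T-≡; ∧-identityʳ; ∧-idem)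
open import Data.Empty using (⊥; ⊥-elim)
open import Data.Fin using (Fin; zero; suc; toℕ; fromℕ; inject₁)
import Data.Fin.Properties as Fin
open import Data.Fin.Relation.Unary.Top using (view; ‵fromℕ; ‵inj₁)
open import Data.List using (List; []; _∷_; map; concatMap; _++_; filterᵇ; length; allFin; tabulate)
open import Data.List.Membership.Propositional using (_∈_)
open import Data.List.Membership.Propositional.Properties using (∈-allFin; ∈-map⁺; ∈-++⁺ˡ; ∈-++⁺ʳ)
open import Data.List.Relation.Unary.Any using (here; there)
open import Data.Product using (_×_; _,_; proj₁; proj₂; ∃)
open import Data.Sum using (_⊎_; inj₁; inj₂)
open import Data.Vec using (Vec; []; _∷_; lookup; _∷ʳ_; zipWith; replicate; _[_]≔_)
open import Data.Vec.Properties using (lookup-zipWith; lookup-replicate; lookup∘update; lookup∘update′)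
open import Function using (_∘_; id)
open import Function.Bundles using (Equivalence)
open import Relation.Binary.Definitions using (tri<; tri≈; tri>)
open import Relation.Binary.PropositionalEquality using (_≡_; _≢_; refl; sym; trans; cong; cong₂; subst; module ≡-Reasoning)
open import Relation.Nullary using (¬_; Dec; yes; no)
open ≡-Reasoning

-- The sign reverses because the entry of row `r` in the new column decides the status of no label
-- but that of `r`. Rows above `r` do not see it. Every present row below `r` already contains a
-- row-restricted 0; for this reason `Pivot` demands that these rows not be `RowUnrestricted`, which
-- is more than not being free, since a diagonal 0 stops a row from being free without restricting
-- it. A column could be spoiled only through a 0 of row `r`, and by `saturated` each such 0 has a 1
-- to its left beforehand. The label of `r` is unrestricted if the entry is 1, and restricted if it
-- is 0 below another 1. The label of the new column is always unrestricted and gives a constant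
-- factor -1.
--
-- The pivot is read off the last label, so a tableau of length 0 has none. Hence the recurrence
-- adds two labels at a time: the first produces the pivot that the second uses.

private variable
  A B : Set
  n : ℕ

-- Finite sums

∑ : List A → (A → ℤ) → ℤ
∑ xs f = sumℤ (map f xs)

∑-cong : (xs : List A) {f g : A → ℤ} → (∀ x → f x ≡ g x) → ∑ xs f ≡ ∑ xs g
∑-cong []       f≗g = refl
∑-cong (x ∷ xs) f≗g = cong₂ _+ℤ_ (f≗g x) (∑-cong xs f≗g)

∑-zero : (xs : List A) {f : A → ℤ} → (∀ x → f x ≡ + 0) → ∑ xs f ≡ + 0
∑-zero []       f≗0 = refl
∑-zero (x ∷ xs) f≗0 = cong₂ _+ℤ_ (f≗0 x) (∑-zero xs f≗0)

+-interchange : ∀ a b c d → (a +ℤ b) +ℤ (c +ℤ d) ≡ (a +ℤ c) +ℤ (b +ℤ d)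
+-interchange a b c d = begin
  (a +ℤ b) +ℤ (c +ℤ d) ≡⟨ ℤ.+-assoc a b (c +ℤ d) ⟩
  a +ℤ (b +ℤ (c +ℤ d)) ≡⟨ cong (a +ℤ_) (sym (ℤ.+-assoc b c d)) ⟩
  a +ℤ ((b +ℤ c) +ℤ d) ≡⟨ cong (λ e → a +ℤ (e +ℤ d)) (ℤ.+-comm b c) ⟩
  a +ℤ ((c +ℤ b) +ℤ d) ≡⟨ cong (a +ℤ_) (ℤ.+-assoc c b d) ⟩
  a +ℤ (c +ℤ (b +ℤ d)) ≡⟨ sym (ℤ.+-assoc a c (b +ℤ d)) ⟩
  (a +ℤ c) +ℤ (b +ℤ d) ∎

∑-+ : (xs : List A) (f g : A → ℤ) → ∑ xs (λ x → f x +ℤ g x) ≡ ∑ xs f +ℤ ∑ xs g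
∑-+ []       f g = refl
∑-+ (x ∷ xs) f g = trans (cong ((f x +ℤ g x) +ℤ_) (∑-+ xs f g))
                         (+-interchange (f x) (g x) (∑ xs f) (∑ xs g))

∑-swap : (xs : List A) (ys : List B) (f : A → B → ℤ) →
         ∑ xs (λ x → ∑ ys (f x)) ≡ ∑ ys (λ y → ∑ xs (λ x → f x y))
∑-swap []       ys f = sym (∑-zero ys λ _ → refl)
∑-swap (x ∷ xs) ys f = trans (cong (∑ ys (f x) +ℤ_) (∑-swap xs ys f))
                             (sym (∑-+ ys (f x) (λ y → ∑ xs (λ x′ → f x′ y))))

∑-++ : (xs ys : List A) (f : A → ℤ) → ∑ (xs ++ ys) f ≡ ∑ xs f +ℤ ∑ ys f
∑-++ []       ys f = sym (ℤ.+-identityˡ (∑ ys f))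
∑-++ (x ∷ xs) ys f = trans (cong (f x +ℤ_) (∑-++ xs ys f)) (sym (ℤ.+-assoc (f x) (∑ xs f) (∑ ys f)))

∑-map : (h : A → B) (xs : List A) (f : B → ℤ) → ∑ (map h xs) f ≡ ∑ xs (f ∘ h)
∑-map h []       f = refl
∑-map h (x ∷ xs) f = cong (f (h x) +ℤ_) (∑-map h xs f)

∑-concatMap : (h : A → List B) (xs : List A) (f : B → ℤ) → ∑ (concatMap h xs) f ≡ ∑ xs (λ x → ∑ (h x) f)
∑-concatMap h []       f = refl
∑-concatMap h (x ∷ xs) f = trans (∑-++ (h x) (concatMap h xs) f) (cong (∑ (h x) f +ℤ_) (∑-concatMap h xs f))

∑-filterᵇ : (p : A → Bool) (xs : List A) (f : A → ℤ) →
            ∑ (filterᵇ p xs) f ≡ ∑ xs (λ x → if p x then f x else + 0)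
∑-filterᵇ p []       f = refl
∑-filterᵇ p (x ∷ xs) f with p x
... | true  = cong (f x +ℤ_) (∑-filterᵇ p xs f)
... | false = trans (∑-filterᵇ p xs f) (sym (ℤ.+-identityˡ _))

∑-if : (b : Bool) (xs : List A) (f g : A → ℤ) →
       (if b then ∑ xs f +ℤ ∑ xs g else + 0) ≡ ∑ xs (λ x → if b then f x +ℤ g x else + 0)
∑-if true  xs f g = sym (∑-+ xs f g)
∑-if false xs f g = sym (∑-zero xs λ _ → refl)

∑-bools : (f : Bool → ℤ) → ∑ bools f ≡ f true +ℤ f false
∑-bools f = cong (f true +ℤ_) (ℤ.+-identityʳ (f false))

∑-bools-only : (b : Bool) (f : Bool → ℤ) → (∀ x → x ≢ b → f x ≡ + 0) → ∑ bools f ≡ f b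
∑-bools-only true  f z = trans (∑-bools f) (trans (cong (f true +ℤ_) (z false λ ())) (ℤ.+-identityʳ _))
∑-bools-only false f z = trans (∑-bools f) (trans (cong (_+ℤ f false) (z true λ ())) (ℤ.+-identityˡ _))

∑-∷ : (xs : List A) (m : ℕ) (f : Vec A (suc m) → ℤ) →
      ∑ (allVecs xs (suc m)) f ≡ ∑ xs (λ x → ∑ (allVecs xs m) (λ v → f (x ∷ v)))
∑-∷ xs m f = trans (∑-concatMap (λ x → map (x ∷_) (allVecs xs m)) xs f)
                   (∑-cong xs λ x → ∑-map (x ∷_) (allVecs xs m) f)

-- `allVecs` branches on the first entry, whereas the label n + 1 of a filling is the last entry of
-- each vector. The two enumerations list the vectors in different orders, so only their sums are
-- compared.
∑-∷ʳ : (xs : List A) (m : ℕ) (f : Vec A (suc m) → ℤ) →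
       ∑ (allVecs xs (suc m)) f ≡ ∑ (allVecs xs m) (λ v → ∑ xs (λ x → f (v ∷ʳ x)))
∑-∷ʳ xs zero    f = begin
  ∑ (allVecs xs 1) f                 ≡⟨ ∑-∷ xs 0 f ⟩
  ∑ xs (λ x → f (x ∷ []) +ℤ + 0)     ≡⟨ ∑-cong xs (λ x → ℤ.+-identityʳ _) ⟩
  ∑ xs (λ x → f (x ∷ []))            ≡⟨ sym (ℤ.+-identityʳ _) ⟩
  ∑ xs (λ x → f (x ∷ [])) +ℤ + 0     ∎
∑-∷ʳ xs (suc m) f = begin
  ∑ (allVecs xs (suc (suc m))) f
    ≡⟨ ∑-∷ xs (suc m) f ⟩
  ∑ xs (λ x → ∑ (allVecs xs (suc m)) (λ v → f (x ∷ v)))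
    ≡⟨ ∑-cong xs (λ x → ∑-∷ʳ xs m (λ v → f (x ∷ v))) ⟩
  ∑ xs (λ x → ∑ (allVecs xs m) (λ v → ∑ xs (λ y → f (x ∷ (v ∷ʳ y)))))
    ≡⟨ sym (∑-∷ xs m (λ v → ∑ xs (λ y → f (v ∷ʳ y)))) ⟩
  ∑ (allVecs xs (suc m)) (λ v → ∑ xs (λ y → f (v ∷ʳ y))) ∎

-- The number `m` of rows is kept apart from their width `n`, so that the induction can remove rows
-- while every row loses its last entry.
∑-addColumn : (m n : ℕ) (f : Vec (Vec Bool (suc n)) m → ℤ) →
  ∑ (allVecs (allVecs bools (suc n)) m) f ≡
  ∑ (allVecs (allVecs bools n) m) (λ M → ∑ (allVecs bools m) (λ c → f (zipWith _∷ʳ_ M c)))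
∑-addColumn zero    n f = cong (_+ℤ + 0) (sym (ℤ.+-identityʳ (f [])))
∑-addColumn (suc m) n f = begin
  ∑ (allVecs (allVecs bools (suc n)) (suc m)) f
    ≡⟨ ∑-∷ (allVecs bools (suc n)) m f ⟩
  ∑ (allVecs bools (suc n)) (λ u → ∑ (allVecs (allVecs bools (suc n)) m) (λ M → f (u ∷ M)))
    ≡⟨ ∑-∷ʳ bools n _ ⟩
  ∑ rows (λ u → ∑ bools (λ x → ∑ (allVecs (allVecs bools (suc n)) m) (λ M → f ((u ∷ʳ x) ∷ M))))
    ≡⟨ ∑-cong rows (λ u → ∑-cong bools (λ x → ∑-addColumn m n (λ M → f ((u ∷ʳ x) ∷ M)))) ⟩
  ∑ rows (λ u → ∑ bools (λ x → ∑ mats (λ M → ∑ cols (λ c → f ((u ∷ʳ x) ∷ zipWith _∷ʳ_ M c)))))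
    ≡⟨ ∑-cong rows (λ u → ∑-swap bools mats (λ x M → ∑ cols (λ c → f ((u ∷ʳ x) ∷ zipWith _∷ʳ_ M c)))) ⟩
  ∑ rows (λ u → ∑ mats (λ M → ∑ bools (λ x → ∑ cols (λ c → f ((u ∷ʳ x) ∷ zipWith _∷ʳ_ M c)))))
    ≡⟨ ∑-cong rows (λ u → ∑-cong mats (λ M → sym (∑-∷ bools m (λ c → f (zipWith _∷ʳ_ (u ∷ M) c))))) ⟩
  ∑ rows (λ u → ∑ mats (λ M → ∑ (allVecs bools (suc m)) (λ c → f (zipWith _∷ʳ_ (u ∷ M) c))))
    ≡⟨ sym (∑-∷ rows m _) ⟩
  ∑ (allVecs rows (suc m)) (λ M → ∑ (allVecs bools (suc m)) (λ c → f (zipWith _∷ʳ_ M c))) ∎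
  where
  rows = allVecs bools n
  mats = allVecs rows m
  cols = allVecs bools m

-- A single differing position is the form in which terms get discarded later: one wrong entry makes
-- a filling invalid or a pair cancel.
∑-only : (v₀ : Vec Bool n) (f : Vec Bool n → ℤ) →
         (∀ v i → lookup v i ≢ lookup v₀ i → f v ≡ + 0) → ∑ (allVecs bools n) f ≡ f v₀
∑-only []               f z = ℤ.+-identityʳ _
∑-only {suc n} (b ∷ v₀) f z = begin
  ∑ (allVecs bools (suc n)) f
    ≡⟨ ∑-∷ bools n f ⟩
  ∑ bools (λ x → ∑ (allVecs bools n) (λ v → f (x ∷ v)))
    ≡⟨ ∑-bools-only b _ (λ x x≢b → ∑-zero (allVecs bools n) (λ v → z (x ∷ v) zero x≢b)) ⟩
  ∑ (allVecs bools n) (λ v → f (b ∷ v))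
    ≡⟨ ∑-only v₀ (λ v → f (b ∷ v)) (λ v i → z (b ∷ v) (suc i)) ⟩
  f (b ∷ v₀) ∎

∑-pair : (i : Fin n) (f : Vec Bool n → ℤ) →
  ∑ (allVecs bools n) f ≡ ∑ (allVecs bools n) (λ v → if lookup v i then f v +ℤ f (v [ i ]≔ false) else + 0)
∑-pair {suc n} zero f = begin
  ∑ (allVecs bools (suc n)) f
    ≡⟨ ∑-∷ bools n f ⟩
  ∑ bools (λ x → ∑ V (λ v → f (x ∷ v)))
    ≡⟨ ∑-bools (λ x → ∑ V (λ v → f (x ∷ v))) ⟩
  ∑ V (λ v → f (true ∷ v)) +ℤ ∑ V (λ v → f (false ∷ v))
    ≡⟨ sym (∑-+ V _ _) ⟩
  ∑ V (λ v → f (true ∷ v) +ℤ f (false ∷ v))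
    ≡⟨ sym (ℤ.+-identityʳ _) ⟩
  ∑ V (λ v → f (true ∷ v) +ℤ f (false ∷ v)) +ℤ + 0
    ≡⟨ cong (∑ V (λ v → f (true ∷ v) +ℤ f (false ∷ v)) +ℤ_) (sym (∑-zero V (λ _ → refl))) ⟩
  ∑ V (λ v → g (true ∷ v)) +ℤ ∑ V (λ v → g (false ∷ v))
    ≡⟨ sym (∑-bools (λ x → ∑ V (λ v → g (x ∷ v)))) ⟩
  ∑ bools (λ x → ∑ V (λ v → g (x ∷ v)))
    ≡⟨ sym (∑-∷ bools n g) ⟩
  ∑ (allVecs bools (suc n)) g ∎
  where
  V = allVecs bools n
  g : Vec Bool (suc n) → ℤ
  g v = if lookup v zero then f v +ℤ f (v [ zero ]≔ false) else + 0
∑-pair {suc n} (suc i) f =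
  trans (∑-∷ bools n f)
  (trans (∑-cong bools (λ x → ∑-pair i (λ v → f (x ∷ v))))
         (sym (∑-∷ bools n _)))

-- Reflection of Boolean connectives

∧-intro : ∀ {a b} → a ≡ true → b ≡ true → a ∧ b ≡ true
∧-intro refl refl = refl

∧-elim : ∀ {a b} → a ∧ b ≡ true → a ≡ true × b ≡ true
∧-elim {true} {true} refl = refl , refl

∨-elim : ∀ {a b} → a ∨ b ≡ true → a ≡ true ⊎ b ≡ true
∨-elim {true}         _ = inj₁ refl
∨-elim {false} {true} _ = inj₂ refl

∨-introʳ : ∀ a {b} → b ≡ true → a ∨ b ≡ true
∨-introʳ true  _    = refl
∨-introʳ false refl = refl

true≢false : ∀ {b} → b ≡ true → b ≡ false → ⊥
true≢false refl ()

¬true⇒false : ∀ {b} → ¬ (b ≡ true) → b ≡ false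
¬true⇒false {true}  ¬t = ⊥-elim (¬t refl)
¬true⇒false {false} ¬t = refl

not-intro : ∀ {b} → ¬ (b ≡ true) → not b ≡ true
not-intro ¬t = cong not (¬true⇒false ¬t)

not-elim : ∀ {b} → not b ≡ true → ¬ (b ≡ true)
not-elim p refl with () ← p

bool-ext : ∀ {a b} → (a ≡ true → b ≡ true) → (b ≡ true → a ≡ true) → a ≡ b
bool-ext {true}          f g = sym (f refl)
bool-ext {false} {true}  f g = g refl
bool-ext {false} {false} f g = refl

all-intro : {p : A → Bool} (xs : List A) → (∀ x → p x ≡ true) → all p xs ≡ true
all-intro []       h = refl
all-intro (x ∷ xs) h = ∧-intro (h x) (all-intro xs h)

all-elim : {p : A → Bool} {xs : List A} → all p xs ≡ true → ∀ {x} → x ∈ xs → p x ≡ true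
all-elim h (here refl) = proj₁ (∧-elim h)
all-elim h (there x∈)  = all-elim (proj₂ (∧-elim h)) x∈

any-intro : {p : A → Bool} {xs : List A} → ∀ {x} → x ∈ xs → p x ≡ true → any p xs ≡ true
any-intro (here refl)               px rewrite px = refl
any-intro {p = p} {xs = y ∷ _} (there x∈) px = ∨-introʳ (p y) (any-intro x∈ px)

any-elim : {p : A → Bool} (xs : List A) → any p xs ≡ true → ∃ λ x → p x ≡ true
any-elim (x ∷ xs) h with ∨-elim h
... | inj₁ px = x , px
... | inj₂ t  = any-elim xs t

∈-allRows : (r : RowLab n) → r ∈ allRows n
∈-allRows (neg j) = ∈-++⁺ˡ (∈-map⁺ neg (∈-allFin j))
∈-allRows {n} (pos i) = ∈-++⁺ʳ (map neg (allFin n)) (∈-map⁺ pos (∈-allFin i))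

-- Signs

-- The sign as a product over the labels rather than a power of their number: labels can then be
-- compared one by one, and the last one split off.
sgn : (n : ℕ) → (Fin n → Bool) → ℤ
sgn zero    f = + 1
sgn (suc n) f = (if f zero then -_ else id) (sgn n (f ∘ suc))

sgn-cong : {f g : Fin n → Bool} → (∀ i → f i ≡ g i) → sgn n f ≡ sgn n g
sgn-cong {zero}  e = refl
sgn-cong {suc n} e = cong₂ (λ b z → (if b then -_ else id) z) (e zero) (sgn-cong (e ∘ suc))

sgn-flip : {f g : Fin n → Bool} (ℓ : Fin n) → (∀ i → i ≢ ℓ → f i ≡ g i) → f ℓ ≡ not (g ℓ) →
           sgn n f ≡ - sgn n g
sgn-flip {suc n} {f} {g} zero    e d rewrite d | sgn-cong {f = f ∘ suc} (λ i → e (suc i) λ ()) with g zero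
... | true  = sym (ℤ.neg-involutive _)
... | false = refl
sgn-flip {suc n} {f} {g} (suc ℓ) e d
  rewrite e zero (λ ()) | sgn-flip {f = f ∘ suc} ℓ (λ i i≢ℓ → e (suc i) (i≢ℓ ∘ Fin.suc-injective)) d with g zero
... | true  = refl
... | false = refl

sgn-last : (f : Fin (suc n) → Bool) → sgn (suc n) f ≡ (if f (fromℕ n) then -_ else id) (sgn n (f ∘ inject₁))
sgn-last {zero}  f = refl
sgn-last {suc n} f rewrite sgn-last (f ∘ suc) with f zero | f (suc (fromℕ n))
... | true  | true  = refl
... | true  | false = refl
... | false | true  = refl
... | false | false = refl

sgn-filterᵇ : (f : Fin n → Bool) → -1ℤ ^ℤ length (filterᵇ f (allFin n)) ≡ sgn n f
sgn-filterᵇ {n} f = go n id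
  where
  -- `allFin n` is the tabulation of `id`, and its tail tabulates another function, so the induction
  -- needs an arbitrary `g`.
  go : ∀ m (g : Fin m → Fin n) → -1ℤ ^ℤ length (filterᵇ f (tabulate g)) ≡ sgn m (f ∘ g)
  go zero    g = refl
  go (suc m) g with f (g zero)
  ... | true  = trans (ℤ.-1*i≡-i _) (cong -_ (go m (g ∘ suc)))
  ... | false = go m (g ∘ suc)

-- Rows, columns and validity of a filling

<ᵇ-intro : ∀ {m n} → m < n → (m <ᵇ n) ≡ true
<ᵇ-intro lt = Equivalence.to T-≡ (ℕ.<⇒<ᵇ lt)

<ᵇ-elim : ∀ {m n} → (m <ᵇ n) ≡ true → m < n
<ᵇ-elim {m} {n} h = ℕ.<ᵇ⇒< m n (Equivalence.from T-≡ h)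

≤ᵇ-intro : ∀ {m n} → m ≤ n → (m ≤ᵇ n) ≡ true
≤ᵇ-intro le = Equivalence.to T-≡ (ℕ.≤⇒≤ᵇ le)

≤ᵇ-elim : ∀ {m n} → (m ≤ᵇ n) ≡ true → m ≤ n
≤ᵇ-elim {m} {n} h = ℕ.≤ᵇ⇒≤ m n (Equivalence.from T-≡ h)

≡ᵇ-intro : ∀ m → (m ≡ᵇ m) ≡ true
≡ᵇ-intro m = Equivalence.to T-≡ (ℕ.≡⇒≡ᵇ m m refl)

≡ᵇ-elim : ∀ {m n} → (m ≡ᵇ n) ≡ true → m ≡ n
≡ᵇ-elim {m} {n} h = ℕ.≡ᵇ⇒≡ m n (Equivalence.from T-≡ h)

label : RowLab n → Fin n
label (neg j) = j
label (pos i) = i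

_≟ᴿ_ : (r r′ : RowLab n) → Dec (r ≡ r′)
neg j ≟ᴿ neg j′ with j Fin.≟ j′
... | yes refl = yes refl
... | no  j≢j′ = no λ { refl → j≢j′ refl }
neg j ≟ᴿ pos i  = no λ ()
pos i ≟ᴿ neg j  = no λ ()
pos i ≟ᴿ pos i′ with i Fin.≟ i′
... | yes refl = yes refl
... | no  i≢i′ = no λ { refl → i≢i′ refl }

-- The Boolean tests of Defs unfold during unification; wrapping them in
-- records keeps the row and column arguments inferable.

record Above (r r′ : RowLab n) : Set where
  constructor above
  field holds : rowAbove r r′ ≡ true

record LeftOf (c c′ : Fin n) : Set where
  constructor leftOf
  field holds : colLeft c c′ ≡ true

record Diagonal (r : RowLab n) (c : Fin n) : Set where
  constructor diagonal
  field holds : isDiag r c ≡ true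

Above-connex : {r r′ : RowLab n} → r ≢ r′ → Above r r′ ⊎ Above r′ r
Above-connex {r = neg j} {neg j′} r≢r′ with ℕ.<-cmp (toℕ j) (toℕ j′)
... | tri< lt _ _ = inj₂ (above (<ᵇ-intro lt))
... | tri≈ _ eq _ = ⊥-elim (r≢r′ (cong neg (Fin.toℕ-injective eq)))
... | tri> _ _ gt = inj₁ (above (<ᵇ-intro gt))
Above-connex {r = neg j} {pos i}  _ = inj₁ (above refl)
Above-connex {r = pos i} {neg j}  _ = inj₂ (above refl)
Above-connex {r = pos i} {pos i′} r≢r′ with ℕ.<-cmp (toℕ i) (toℕ i′)
... | tri< lt _ _ = inj₁ (above (<ᵇ-intro lt))
... | tri≈ _ eq _ = ⊥-elim (r≢r′ (cong pos (Fin.toℕ-injective eq)))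
... | tri> _ _ gt = inj₂ (above (<ᵇ-intro gt))

present : Shape n → RowLab n → Bool
present s (neg j) = isCol s j
present s (pos i) = isRow s i

record Present (s : Shape n) (r : RowLab n) : Set where
  constructor mkPresent
  field holds : present s r ≡ true

module _ {n : ℕ} (T : Filling n) where
  open Filling T

  record One (r : RowLab n) (c : Fin n) : Set where
    constructor mkOne
    field holds : one T r c ≡ true

  record Zero (r : RowLab n) (c : Fin n) : Set where
    constructor mkZero
    field holds : zero' T r c ≡ true

  record RowUnrestricted (r : RowLab n) : Set where
    constructor mkRowUnrestricted
    field noAbove : ∀ {c r′} → Zero r c → ¬ Diagonal r c → Above r′ r → ¬ One r′ c

  record ColUnrestricted (c : Fin n) : Set where
    constructor mkColUnrestricted
    field noLeft : ∀ {r c′} → Zero r c → LeftOf c′ c → ¬ One r c′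

  inUR : Fin n → Bool
  inUR ℓ = inURR T ℓ ∨ inURC T ℓ

  data UR (ℓ : Fin n) : Set where
    viaRow : ∀ {c} → isRow shape ℓ ≡ true → RowUnrestricted (pos ℓ) → One (pos ℓ) c → UR ℓ
    viaCol : isCol shape ℓ ≡ true → ColUnrestricted ℓ → RowUnrestricted (neg ℓ) → UR ℓ

  -- The value 0 off the tableaux lets all sums run over arbitrary fillings, so no bijection between
  -- sets of tableaux has to be built.
  weight : ℤ
  weight = if isPTB T then signB T else + 0

  record Valid : Set where
    field
      outside    : ∀ r c → isCell shape r c ≡ false → entry T r c ≡ false
      columnOne  : ∀ c → isCol shape c ≡ true → ∃ λ r → One r c
      noElbow    : ∀ {r c r′ c′} → Zero r c → Above r′ r → One r′ c → LeftOf c′ c → ¬ One r c′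
      noDiagonal : ∀ {r c c′} → Zero r c → Diagonal r c → LeftOf c′ c → ¬ One r c′

  -- A further (leftmost) column may have a 1 exactly in the free rows.
  record Free (r : RowLab n) : Set where
    field
      isPresent : Present shape r
      noDiag    : ∀ {c} → Zero r c → ¬ Diagonal r c
      noAbove   : ∀ {c r′} → Zero r c → Above r′ r → ¬ One r′ c

  -- The lowest free row, with the extra property that a 1 to the left of it
  -- restricts no further column.
  record Pivot (r : RowLab n) : Set where
    field
      free      : Free r
      lowest    : ∀ {r′} → Above r r′ → Present shape r′ → ¬ RowUnrestricted r′
      saturated : ∀ {c} → Zero r c → ∃ λ c′ → LeftOf c′ c × One r c′

module _ {T : Filling n} where
  open Filling T

  one-zero-disjoint : ∀ {r c} → One T r c → ¬ Zero T r c
  one-zero-disjoint {r} {c} (mkOne o) (mkZero z) =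
    not-elim (proj₂ (∧-elim {isCell shape r c} z)) (proj₂ (∧-elim {isCell shape r c} o))

  ¬one⇒zero : ∀ {r c} → isCell shape r c ≡ true → ¬ One T r c → Zero T r c
  ¬one⇒zero ic ¬o = mkZero (∧-intro ic (not-intro (¬o ∘ mkOne ∘ ∧-intro ic)))

  ¬zero⇒one : ∀ {r c} → isCell shape r c ≡ true → ¬ Zero T r c → One T r c
  ¬zero⇒one {r} {c} ic ¬z with entry T r c in eq
  ... | true  = mkOne (∧-intro ic eq)
  ... | false = ⊥-elim (¬z (mkZero (∧-intro ic (cong not eq))))

  oneAbove-intro : ∀ {r c r′} → Above r′ r → One T r′ c → oneAbove T r c ≡ true
  oneAbove-intro {r′ = r′} (above a) (mkOne o) = any-intro (∈-allRows r′) (∧-intro a o)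

  oneAbove-elim : ∀ r c → oneAbove T r c ≡ true → ∃ λ r′ → Above r′ r × One T r′ c
  oneAbove-elim r c h = let r′ , p = any-elim (allRows n) h
                            a , o = ∧-elim p in r′ , above a , mkOne o

  oneLeft-intro : ∀ {r c c′} → LeftOf c′ c → One T r c′ → oneLeft T r c ≡ true
  oneLeft-intro {c′ = c′} (leftOf l) (mkOne o) = any-intro (∈-allFin c′) (∧-intro l o)

  oneLeft-elim : ∀ r c → oneLeft T r c ≡ true → ∃ λ c′ → LeftOf c′ c × One T r c′
  oneLeft-elim r c h = let c′ , p = any-elim (allFin n) h
                           l , o = ∧-elim p in c′ , leftOf l , mkOne o

  noRowRestricted-intro : ∀ {r} → RowUnrestricted T r → noRowRestricted T r ≡ true
  noRowRestricted-intro {r} (mkRowUnrestricted h) = all-intro (allFin n) λ c → not-intro λ rr →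
    let z , q = ∧-elim rr
        d , a = ∧-elim q
        _ , a , o = oneAbove-elim r c a
    in h (mkZero z) (not-elim d ∘ Diagonal.holds) a o

  noRowRestricted-elim : ∀ {r} → noRowRestricted T r ≡ true → RowUnrestricted T r
  noRowRestricted-elim h = mkRowUnrestricted λ {c} (mkZero z) ¬d a o → not-elim (all-elim h (∈-allFin c))
    (∧-intro z (∧-intro (not-intro (¬d ∘ diagonal)) (oneAbove-intro a o)))

  noColRestricted-intro : ∀ {c} → ColUnrestricted T c → all (λ r → not (colRestricted T r c)) (allRows n) ≡ true
  noColRestricted-intro {c} (mkColUnrestricted h) = all-intro (allRows n) λ r → not-intro λ cr →
    let z , l = ∧-elim cr
        _ , l , o = oneLeft-elim r c l
    in h (mkZero z) l o

  noColRestricted-elim : ∀ {c} → all (λ r → not (colRestricted T r c)) (allRows n) ≡ true → ColUnrestricted T c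
  noColRestricted-elim h = mkColUnrestricted λ {r} (mkZero z) l o →
    not-elim (all-elim h (∈-allRows r)) (∧-intro z (oneLeft-intro l o))

  inUR-intro : ∀ {ℓ} → UR T ℓ → inUR T ℓ ≡ true
  inUR-intro {ℓ} (viaRow {c} ir u (mkOne o)) =
    cong (_∨ inURC T ℓ) (∧-intro ir (∧-intro (noRowRestricted-intro u) (any-intro (∈-allFin c) o)))
  inUR-intro {ℓ} (viaCol ic u u′) =
    ∨-introʳ (inURR T ℓ) (∧-intro ic (∧-intro (noColRestricted-intro u) (noRowRestricted-intro u′)))

  inUR-elim : ∀ {ℓ} → inUR T ℓ ≡ true → UR T ℓ
  inUR-elim h with ∨-elim h
  ... | inj₁ p = let a , p = ∧-elim p
                     b , p = ∧-elim p
                     _ , o = any-elim (allFin n) p in viaRow a (noRowRestricted-elim b) (mkOne o)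
  ... | inj₂ p = let a , p = ∧-elim p
                     b , p = ∧-elim p in viaCol a (noColRestricted-elim b) (noRowRestricted-elim p)

  isPTB⇒Valid : isPTB T ≡ true → Valid T
  isPTB⇒Valid h = let h₀ , h = ∧-elim h
                      h₁ , h = ∧-elim h
                      h₂ , h₃ = ∧-elim h in record
    { outside = λ r c nc → outside′ nc (all-elim (all-elim h₀ (∈-allRows r)) (∈-allFin c))
    ; columnOne = λ c ic → columnOne′ ic (all-elim h₁ (∈-allFin c))
    ; noElbow = λ {r} {c} (mkZero z) a o l o′ → not-elim (all-elim (all-elim h₂ (∈-allRows r)) (∈-allFin c))
        (∧-intro z (∧-intro (oneAbove-intro a o) (oneLeft-intro l o′)))
    ; noDiagonal = λ {r} {c} (mkZero z) (diagonal d) l o →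
        not-elim (all-elim (all-elim h₃ (∈-allRows r)) (∈-allFin c)) (∧-intro z (∧-intro d (oneLeft-intro l o)))
    }
    where
    outside′ : ∀ {a b} → a ≡ false → a ∨ not b ≡ true → b ≡ false
    outside′ {b = false} refl _ = refl
    columnOne′ : ∀ {a c} → a ≡ true → not a ∨ any (λ r → one T r c) (allRows n) ≡ true → ∃ λ r → One T r c
    columnOne′ refl p = let r , o = any-elim (allRows n) p in r , mkOne o

  Valid⇒isPTB : Valid T → isPTB T ≡ true
  Valid⇒isPTB v = ∧-intro
    (all-intro (allRows n) λ r → all-intro (allFin n) λ c → outside′ (outside r c))
    (∧-intro (all-intro (allFin n) λ c → columnOne′ (columnOne c))
    (∧-intro
      (all-intro (allRows n) λ r → all-intro (allFin n) λ c → not-intro λ h →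
        let z , h = ∧-elim h
            a , l = ∧-elim h
            _ , a , o = oneAbove-elim r c a
            _ , l , o′ = oneLeft-elim r c l
        in noElbow (mkZero z) a o l o′)
      (all-intro (allRows n) λ r → all-intro (allFin n) λ c → not-intro λ h →
        let z , h = ∧-elim h
            d , l = ∧-elim h
            _ , l , o = oneLeft-elim r c l
        in noDiagonal (mkZero z) (diagonal d) l o)))
    where
    open Valid v
    outside′ : ∀ {a b} → (a ≡ false → b ≡ false) → a ∨ not b ≡ true
    outside′ {true}  _ = refl
    outside′ {false} h = cong not (h refl)
    columnOne′ : ∀ {a c} → (a ≡ true → ∃ λ r → One T r c) → not a ∨ any (λ r → one T r c) (allRows n) ≡ true
    columnOne′ {false} _ = refl
    columnOne′ {true}  h = let r , mkOne o = h refl in any-intro (∈-allRows r) o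

  valid? : Dec (Valid T)
  valid? with isPTB T in eq
  ... | true  = yes (isPTB⇒Valid eq)
  ... | false = no λ v → true≢false (Valid⇒isPTB v) eq

  one⇒isCell : ∀ {r c} → One T r c → isCell shape r c ≡ true
  one⇒isCell (mkOne o) = proj₁ (∧-elim o)

  zero⇒isCell : ∀ {r c} → Zero T r c → isCell shape r c ≡ true
  zero⇒isCell (mkZero z) = proj₁ (∧-elim z)

  -- The diagonal cell is the topmost cell of column `j`. A 1 there lies above every 0 of the
  -- column, and such a 0 with a 1 to its left would violate condition (2).
  diagonal-one⇒ColUnrestricted : Valid T → ∀ {j} → One T (neg j) j → ColUnrestricted T j
  diagonal-one⇒ColUnrestricted v {j} o = mkColUnrestricted λ {r} → go r
    where
    open Valid v
    go : ∀ r {c′} → Zero T r j → LeftOf c′ j → ¬ One T r c′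
    go (pos i)  z l o′ = noElbow z (above refl) o l o′
    go (neg j′) z l o′ with ℕ.<-cmp (toℕ j′) (toℕ j)
    ... | tri< lt _ _ = noElbow z (above (<ᵇ-intro lt)) o l o′
    ... | tri≈ _ eq _ = one-zero-disjoint (subst (λ k → One T (neg k) j) (sym (Fin.toℕ-injective eq)) o) z
    ... | tri> _ _ gt = ℕ.<⇒≱ gt (≤ᵇ-elim (proj₂ (∧-elim {isCol shape j} (proj₂ (∧-elim {isCol shape j′} (zero⇒isCell z))))))

  Free⇒RowUnrestricted : ∀ {r} → Free T r → RowUnrestricted T r
  Free⇒RowUnrestricted f = mkRowUnrestricted λ z _ → Free.noAbove f z

weight-valid : (T : Filling n) → Valid T → weight T ≡ sgn n (inUR T)
weight-valid T v rewrite Valid⇒isPTB v = sgn-filterᵇ (inUR T)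

weight-invalid : (T : Filling n) → ¬ Valid T → weight T ≡ + 0
weight-invalid T ¬v rewrite ¬true⇒false (¬v ∘ isPTB⇒Valid) = refl

-- Adding the label n + 1

lookup-∷ʳ-inject₁ : (v : Vec A n) (x : A) (i : Fin n) → lookup (v ∷ʳ x) (inject₁ i) ≡ lookup v i
lookup-∷ʳ-inject₁ (y ∷ v) x zero    = refl
lookup-∷ʳ-inject₁ (y ∷ v) x (suc i) = lookup-∷ʳ-inject₁ v x i

lookup-∷ʳ-fromℕ : (v : Vec A n) (x : A) → lookup (v ∷ʳ x) (fromℕ n) ≡ x
lookup-∷ʳ-fromℕ []      x = refl
lookup-∷ʳ-fromℕ (y ∷ v) x = lookup-∷ʳ-fromℕ v x

border : Vec (Vec Bool n) n → Vec Bool n → Vec Bool n → Bool → Vec (Vec Bool (suc n)) (suc n)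
border M c u d = zipWith _∷ʳ_ M c ∷ʳ (u ∷ʳ d)

module _ (M : Vec (Vec Bool n) n) (c u : Vec Bool n) (d : Bool) where
  border-row : ∀ i → lookup (border M c u d) (inject₁ i) ≡ lookup M i ∷ʳ lookup c i
  border-row i = trans (lookup-∷ʳ-inject₁ (zipWith _∷ʳ_ M c) (u ∷ʳ d) i) (lookup-zipWith _∷ʳ_ i M c)

  border-old : ∀ i j → lookup (lookup (border M c u d) (inject₁ i)) (inject₁ j) ≡ lookup (lookup M i) j
  border-old i j rewrite border-row i = lookup-∷ʳ-inject₁ (lookup M i) (lookup c i) j

  border-column : ∀ i → lookup (lookup (border M c u d) (inject₁ i)) (fromℕ n) ≡ lookup c i
  border-column i rewrite border-row i = lookup-∷ʳ-fromℕ (lookup M i) (lookup c i)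

  border-lastRow : ∀ j → lookup (lookup (border M c u d) (fromℕ n)) (inject₁ j) ≡ lookup u j
  border-lastRow j rewrite lookup-∷ʳ-fromℕ (zipWith _∷ʳ_ M c) (u ∷ʳ d) = lookup-∷ʳ-inject₁ u d j

  border-corner : lookup (lookup (border M c u d) (fromℕ n)) (fromℕ n) ≡ d
  border-corner rewrite lookup-∷ʳ-fromℕ (zipWith _∷ʳ_ M c) (u ∷ʳ d) = lookup-∷ʳ-fromℕ u d

-- The entries of a column in the positive rows, in the other negative rows,
-- and in its diagonal cell.
record Column (n : ℕ) : Set where
  constructor mkColumn
  field
    positive negative : Vec Bool n
    corner            : Bool
open Column

infix 8 _!_
_!_ : Column n → RowLab n → Bool
c ! pos i = lookup (positive c) i
c ! neg j = lookup (negative c) j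

set : RowLab n → Bool → Column n → Column n
set (pos i) b (mkColumn p q d) = mkColumn (p [ i ]≔ b) q d
set (neg j) b (mkColumn p q d) = mkColumn p (q [ j ]≔ b) d

set-same : ∀ (r : RowLab n) b c → set r b c ! r ≡ b
set-same (pos i) b c = lookup∘update i (positive c) b
set-same (neg j) b c = lookup∘update j (negative c) b

set-other : ∀ (r : RowLab n) b c {r′} → r′ ≢ r → set r b c ! r′ ≡ c ! r′
set-other (pos i) b c {pos i′} r′≢r = lookup∘update′ (r′≢r ∘ cong pos) (positive c) b
set-other (pos i) b c {neg j′} r′≢r = refl
set-other (neg j) b c {pos i′} r′≢r = refl
set-other (neg j) b c {neg j′} r′≢r = lookup∘update′ (r′≢r ∘ cong neg) (negative c) b

set-corner : ∀ (r : RowLab n) b c → corner (set r b c) ≡ corner c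
set-corner (pos i) b c = refl
set-corner (neg j) b c = refl

zeros : Column n
zeros {n} = mkColumn (replicate n false) (replicate n false) false

zeros-! : (r : RowLab n) → zeros ! r ≡ false
zeros-! (pos i) = lookup-replicate i false
zeros-! (neg j) = lookup-replicate j false

-- Row n + 1 has no cells and row -(n + 1) at most its diagonal one, so the new matrix rows are zero
-- except possibly for `corner`. With `b = true` there is no new column, and validity will force the
-- argument to be `zeros`.
ext : Filling n → Bool → Column n → Filling (suc n)
ext {n} (mkFilling s P N) b (mkColumn p q d) =
  mkFilling (s ∷ʳ b) (border P p (replicate n false) false) (border N q (replicate n false) d)

old : RowLab n → RowLab (suc n)
old (neg j) = neg (inject₁ j)
old (pos i) = pos (inject₁ i)

data RowView : RowLab (suc n) → Set where
  isOld  : (r : RowLab n) → RowView (old r)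
  newNeg : RowView {n} (neg (fromℕ n))
  newPos : RowView {n} (pos (fromℕ n))

rowView : (r : RowLab (suc n)) → RowView r
rowView (neg j) with view j
... | ‵fromℕ       = newNeg
... | ‵inj₁ {i = i} _ = isOld (neg i)
rowView (pos i) with view i
... | ‵fromℕ       = newPos
... | ‵inj₁ {i = i} _ = isOld (pos i)

data ColView : Fin (suc n) → Set where
  isOld : (c : Fin n) → ColView (inject₁ c)
  new   : ColView (fromℕ n)

colView : (c : Fin (suc n)) → ColView c
colView c with view c
... | ‵fromℕ       = new
... | ‵inj₁ {i = i} _ = isOld i

inject₁<new : (i : Fin n) → toℕ (inject₁ i) < toℕ (fromℕ n)
inject₁<new {n} i rewrite Fin.toℕ-fromℕ n | Fin.toℕ-inject₁ i = Fin.toℕ<n i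

rowAbove-old : (r r′ : RowLab n) → rowAbove (old r) (old r′) ≡ rowAbove r r′
rowAbove-old (neg j) (neg j′) rewrite Fin.toℕ-inject₁ j | Fin.toℕ-inject₁ j′ = refl
rowAbove-old (neg j) (pos i)  = refl
rowAbove-old (pos i) (neg j)  = refl
rowAbove-old (pos i) (pos i′) rewrite Fin.toℕ-inject₁ i | Fin.toℕ-inject₁ i′ = refl

above-old⁺ : {r r′ : RowLab n} → Above r r′ → Above (old r) (old r′)
above-old⁺ {r = r} {r′} (above a) = above (trans (rowAbove-old r r′) a)

above-old⁻ : {r r′ : RowLab n} → Above (old r) (old r′) → Above r r′
above-old⁻ {r = r} {r′} (above a) = above (trans (sym (rowAbove-old r r′)) a)

newNeg-above : (r : RowLab n) → Above (neg (fromℕ n)) (old r)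
newNeg-above (neg j) = above (<ᵇ-intro (inject₁<new j))
newNeg-above (pos i) = above refl

¬above-newNeg : {r : RowLab (suc n)} → ¬ Above r (neg (fromℕ n))
¬above-newNeg {r = neg j} (above a) = ℕ.<⇒≱ (<ᵇ-elim a) (Fin.≤fromℕ j)
¬above-newNeg {r = pos i} (above ())

¬newPos-above : {r : RowLab (suc n)} → ¬ Above (pos (fromℕ n)) r
¬newPos-above {r = neg j} (above ())
¬newPos-above {r = pos i} (above a) = ℕ.<⇒≱ (<ᵇ-elim a) (Fin.≤fromℕ i)

leftOf-old⁺ : {c c′ : Fin n} → LeftOf c c′ → LeftOf (inject₁ c) (inject₁ c′)
leftOf-old⁺ {c = c} {c′} (leftOf l) =
  leftOf (trans (cong₂ _<ᵇ_ (Fin.toℕ-inject₁ c′) (Fin.toℕ-inject₁ c)) l)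

leftOf-old⁻ : {c c′ : Fin n} → LeftOf (inject₁ c) (inject₁ c′) → LeftOf c c′
leftOf-old⁻ {c = c} {c′} (leftOf l) =
  leftOf (trans (sym (cong₂ _<ᵇ_ (Fin.toℕ-inject₁ c′) (Fin.toℕ-inject₁ c))) l)

new-leftOf : {c : Fin n} → LeftOf (fromℕ n) (inject₁ c)
new-leftOf {c = c} = leftOf (<ᵇ-intro (inject₁<new c))

¬leftOf-new : {c : Fin (suc n)} → ¬ LeftOf c (fromℕ n)
¬leftOf-new {c = c} (leftOf l) = ℕ.<⇒≱ (<ᵇ-elim l) (Fin.≤fromℕ c)

isDiag-old : (r : RowLab n) (c : Fin n) → isDiag (old r) (inject₁ c) ≡ isDiag r c
isDiag-old (neg j) c rewrite Fin.toℕ-inject₁ j | Fin.toℕ-inject₁ c = refl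
isDiag-old (pos i) c = refl

diagonal-old⁺ : {r : RowLab n} {c : Fin n} → Diagonal r c → Diagonal (old r) (inject₁ c)
diagonal-old⁺ {r = r} {c} (diagonal d) = diagonal (trans (isDiag-old r c) d)

diagonal-old⁻ : {r : RowLab n} {c : Fin n} → Diagonal (old r) (inject₁ c) → Diagonal r c
diagonal-old⁻ {r = r} {c} (diagonal d) = diagonal (trans (sym (isDiag-old r c)) d)

¬diagonal-new : {r : RowLab n} → ¬ Diagonal (old r) (fromℕ n)
¬diagonal-new {r = neg j} (diagonal d) = ℕ.<⇒≢ (inject₁<new j) (≡ᵇ-elim d)
¬diagonal-new {r = pos i} (diagonal ())

module _ (T : Filling n) (b : Bool) (c : Column n) where
  open Filling T using (shape; P; N)
  private
    T′ = ext T b c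
    s′ = Filling.shape T′

  isRow-old : ∀ i → isRow s′ (inject₁ i) ≡ isRow shape i
  isRow-old i = lookup-∷ʳ-inject₁ shape b i

  isRow-new : isRow s′ (fromℕ n) ≡ b
  isRow-new = lookup-∷ʳ-fromℕ shape b

  present-old : ∀ r → present s′ (old r) ≡ present shape r
  present-old (neg j) = cong not (isRow-old j)
  present-old (pos i) = isRow-old i

  isCell-old : ∀ r k → isCell s′ (old r) (inject₁ k) ≡ isCell shape r k
  isCell-old (neg j) k rewrite isRow-old j | isRow-old k | Fin.toℕ-inject₁ j | Fin.toℕ-inject₁ k = refl
  isCell-old (pos i) k rewrite isRow-old i | isRow-old k | Fin.toℕ-inject₁ i | Fin.toℕ-inject₁ k = refl

  isCell-new : ∀ r → isCell s′ (old r) (fromℕ n) ≡ present shape r ∧ not b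
  isCell-new (neg j) rewrite isRow-old j | isRow-new | ≤ᵇ-intro (ℕ.<⇒≤ (inject₁<new j)) | ∧-identityʳ (not b) = refl
  isCell-new (pos i) rewrite isRow-old i | isRow-new | <ᵇ-intro (inject₁<new i) | ∧-identityʳ (not b) = refl

  isCell-newNeg : ∀ k → isCell s′ (neg (fromℕ n)) (inject₁ k) ≡ false
  isCell-newNeg k = ¬true⇒false λ h → ℕ.<⇒≱ (inject₁<new k)
    (≤ᵇ-elim (proj₂ (∧-elim {isCol s′ (inject₁ k)} (proj₂ (∧-elim {isCol s′ (fromℕ n)} h)))))

  isCell-newPos : ∀ k → isCell s′ (pos (fromℕ n)) k ≡ false
  isCell-newPos k = ¬true⇒false λ h → ℕ.<⇒≱
    (<ᵇ-elim (proj₂ (∧-elim {isCol s′ k} (proj₂ (∧-elim {isRow s′ (fromℕ n)} h))))) (Fin.≤fromℕ k)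

  isCell-corner : isCell s′ (neg (fromℕ n)) (fromℕ n) ≡ not b
  isCell-corner rewrite isRow-new | ≤ᵇ-intro (ℕ.≤-refl {toℕ (fromℕ n)}) | ∧-identityʳ (not b) =
    ∧-idem (not b)

  entry-old : ∀ r k → entry T′ (old r) (inject₁ k) ≡ entry T r k
  entry-old (neg j) k = border-old N (negative c) _ (corner c) j k
  entry-old (pos i) k = border-old P (positive c) _ false i k

  entry-new : ∀ r → entry T′ (old r) (fromℕ n) ≡ c ! r
  entry-new (neg j) = border-column N (negative c) _ (corner c) j
  entry-new (pos i) = border-column P (positive c) _ false i

  entry-corner : entry T′ (neg (fromℕ n)) (fromℕ n) ≡ corner c
  entry-corner = border-corner N (negative c) _ (corner c)

  entry-newNeg : ∀ k → entry T′ (neg (fromℕ n)) (inject₁ k) ≡ false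
  entry-newNeg k = trans (border-lastRow N (negative c) _ (corner c) k) (lookup-replicate k false)

  entry-newPos : ∀ k → entry T′ (pos (fromℕ n)) k ≡ false
  entry-newPos k with colView k
  ... | isOld k = trans (border-lastRow P (positive c) _ false k) (lookup-replicate k false)
  ... | new     = border-corner P (positive c) _ false

module _ {T : Filling n} {b : Bool} {c : Column n} where
  open Filling T using (shape)
  private
    T′ = ext T b c

  present-old⁺ : ∀ {r} → Present shape r → Present (Filling.shape T′) (old r)
  present-old⁺ {r} (mkPresent p) = mkPresent (trans (present-old T b c r) p)

  present-old⁻ : ∀ {r} → Present (Filling.shape T′) (old r) → Present shape r
  present-old⁻ {r} (mkPresent p) = mkPresent (trans (sym (present-old T b c r)) p)

  one-old⁺ : ∀ {r k} → One T r k → One T′ (old r) (inject₁ k)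
  one-old⁺ {r} {k} (mkOne o) = mkOne (trans (cong₂ _∧_ (isCell-old T b c r k) (entry-old T b c r k)) o)

  one-old⁻ : ∀ {r k} → One T′ (old r) (inject₁ k) → One T r k
  one-old⁻ {r} {k} (mkOne o) = mkOne (trans (sym (cong₂ _∧_ (isCell-old T b c r k) (entry-old T b c r k))) o)

  zero-old⁺ : ∀ {r k} → Zero T r k → Zero T′ (old r) (inject₁ k)
  zero-old⁺ {r} {k} (mkZero z) =
    mkZero (trans (cong₂ (λ x y → x ∧ not y) (isCell-old T b c r k) (entry-old T b c r k)) z)

  zero-old⁻ : ∀ {r k} → Zero T′ (old r) (inject₁ k) → Zero T r k
  zero-old⁻ {r} {k} (mkZero z) =
    mkZero (trans (sym (cong₂ (λ x y → x ∧ not y) (isCell-old T b c r k) (entry-old T b c r k))) z)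

  one-new⁺ : ∀ {r} → Present shape r → b ≡ false → c ! r ≡ true → One T′ (old r) (fromℕ n)
  one-new⁺ {r} (mkPresent p) b≡f e = mkOne (∧-intro
    (trans (isCell-new T b c r) (∧-intro p (cong not b≡f))) (trans (entry-new T b c r) e))

  one-new⁻ : ∀ {r} → One T′ (old r) (fromℕ n) → c ! r ≡ true
  one-new⁻ {r} (mkOne o) =
    trans (sym (entry-new T b c r)) (proj₂ (∧-elim {isCell (Filling.shape T′) (old r) (fromℕ n)} o))

  zero-new⁺ : ∀ {r} → Present shape r → b ≡ false → c ! r ≡ false → Zero T′ (old r) (fromℕ n)
  zero-new⁺ {r} (mkPresent p) b≡f e = mkZero (∧-intro
    (trans (isCell-new T b c r) (∧-intro p (cong not b≡f))) (cong not (trans (entry-new T b c r) e)))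

  zero-new⁻ : ∀ {r} → Zero T′ (old r) (fromℕ n) → c ! r ≡ false
  zero-new⁻ {r} (mkZero z) = ¬true⇒false λ e →
    not-elim (proj₂ (∧-elim {isCell (Filling.shape T′) (old r) (fromℕ n)} z)) (trans (entry-new T b c r) e)

  cell-new-present : ∀ {r} → isCell (Filling.shape T′) (old r) (fromℕ n) ≡ true → Present shape r
  cell-new-present {r} h = mkPresent (proj₁ (∧-elim (trans (sym (isCell-new T b c r)) h)))

  ¬cell-newNeg : ∀ {k} → ¬ (isCell (Filling.shape T′) (neg (fromℕ n)) (inject₁ k) ≡ true)
  ¬cell-newNeg h = true≢false h (isCell-newNeg T b c _)

  ¬cell-newPos : ∀ {k} → ¬ (isCell (Filling.shape T′) (pos (fromℕ n)) k ≡ true)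
  ¬cell-newPos h = true≢false h (isCell-newPos T b c _)

  one-corner⁺ : b ≡ false → corner c ≡ true → One T′ (neg (fromℕ n)) (fromℕ n)
  one-corner⁺ b≡f d = mkOne (∧-intro (trans (isCell-corner T b c) (cong not b≡f)) (trans (entry-corner T b c) d))

  one-corner⁻ : One T′ (neg (fromℕ n)) (fromℕ n) → corner c ≡ true
  one-corner⁻ (mkOne o) = trans (sym (entry-corner T b c))
    (proj₂ (∧-elim {isCell (Filling.shape T′) (neg (fromℕ n)) (fromℕ n)} o))

-- Validity of an extension

module _ (T : Filling n) (b : Bool) (c : Column n) where
  open Filling T using (shape)
  private
    T′ = ext T b c

  -- A new 1 is the leftmost entry of its row and constrains only the 0s to its right, which is what
  -- freeness controls. A 0 in the new column has nothing to its left and is never constrained.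
  record Extendable : Set where
    field
      base     : Valid T
      onFree   : ∀ r → c ! r ≡ true → b ≡ false × Free T r
      cornerOk : corner c ≡ true → b ≡ false
      nonEmpty : b ≡ false → corner c ≡ true ⊎ ∃ λ r → c ! r ≡ true

  Valid⇒Extendable : Valid T′ → Extendable
  Valid⇒Extendable v = record
    { base = record
      { outside    = λ r k nc → trans (sym (entry-old T b c r k))
                                      (outside (old r) (inject₁ k) (trans (isCell-old T b c r k) nc))
      ; columnOne  = λ k ic → columnOne′ (columnOne (inject₁ k) (trans (cong not (isRow-old T b c k)) ic))
      ; noElbow    = λ z a o l o′ →
          noElbow (zero-old⁺ z) (above-old⁺ a) (one-old⁺ o) (leftOf-old⁺ l) (one-old⁺ o′)
      ; noDiagonal = λ z d l o → noDiagonal (zero-old⁺ z) (diagonal-old⁺ d) (leftOf-old⁺ l) (one-old⁺ o)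
      }
    ; onFree   = λ r e → let p , b≡f = onCell r e
                             o = one-new⁺ p b≡f e in b≡f , record
        { isPresent = p
        ; noDiag    = λ z d → noDiagonal (zero-old⁺ z) (diagonal-old⁺ d) new-leftOf o
        ; noAbove   = λ z a o′ → noElbow (zero-old⁺ z) (above-old⁺ a) (one-old⁺ o′) new-leftOf o
        }
    ; cornerOk = λ e → ¬true⇒false λ b≡t → true≢false (trans (entry-corner T b c) e)
        (outside (neg (fromℕ n)) (fromℕ n) (trans (isCell-corner T b c) (cong not b≡t)))
    ; nonEmpty = λ b≡f → nonEmpty′ (columnOne (fromℕ n) (cong not (trans (isRow-new T b c) b≡f)))
    }
    where
    open Valid v
    columnOne′ : ∀ {k} → (∃ λ r → One T′ r (inject₁ k)) → ∃ λ r → One T r k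
    columnOne′ (r , o) with rowView r
    ... | isOld r = r , one-old⁻ o
    ... | newNeg  = ⊥-elim (¬cell-newNeg {T = T} {b} {c} (one⇒isCell o))
    ... | newPos  = ⊥-elim (¬cell-newPos {T = T} {b} {c} (one⇒isCell o))
    onCell : ∀ r → c ! r ≡ true → Present shape r × b ≡ false
    onCell r e with present shape r ∧ not b in eq
    ... | true  = let p , nb = ∧-elim eq in mkPresent p , ¬true⇒false (not-elim nb)
    ... | false = ⊥-elim (true≢false (trans (entry-new T b c r) e)
                    (outside (old r) (fromℕ n) (trans (isCell-new T b c r) eq)))
    nonEmpty′ : (∃ λ r → One T′ r (fromℕ n)) → corner c ≡ true ⊎ ∃ λ r → c ! r ≡ true
    nonEmpty′ (r , o) with rowView r
    ... | isOld r = inj₂ (r , one-new⁻ {T = T} o)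
    ... | newNeg  = inj₁ (one-corner⁻ {T = T} o)
    ... | newPos  = ⊥-elim (¬cell-newPos {T = T} {b} {c} (one⇒isCell o))

  Extendable⇒Valid : Extendable → Valid T′
  Extendable⇒Valid x = record
    { outside = outside′ ; columnOne = columnOne′ ; noElbow = λ {r} → noElbow′ r ; noDiagonal = λ {r} → noDiagonal′ r }
    where
    open Extendable x
    open Valid base
    outside′ : ∀ r k → isCell (Filling.shape T′) r k ≡ false → entry T′ r k ≡ false
    outside′ r k nc with rowView r | colView k
    ... | isOld r | isOld k = trans (entry-old T b c r k) (outside r k (trans (sym (isCell-old T b c r k)) nc))
    ... | isOld r | new     = ¬true⇒false λ e →
      let b≡f , f = onFree r (trans (sym (entry-new T b c r)) e)
      in true≢false (one⇒isCell (one-new⁺ {T = T} (Free.isPresent f) b≡f (trans (sym (entry-new T b c r)) e))) nc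
    ... | newNeg  | isOld k = entry-newNeg T b c k
    ... | newNeg  | new     = ¬true⇒false λ e →
      let d = trans (sym (entry-corner T b c)) e
      in true≢false (one⇒isCell (one-corner⁺ {T = T} {b} {c} (cornerOk d) d)) nc
    ... | newPos  | _       = entry-newPos T b c k
    columnOne′ : ∀ k → isCol (Filling.shape T′) k ≡ true → ∃ λ r → One T′ r k
    columnOne′ k ic with colView k
    ... | isOld k = let r , o = columnOne k (trans (cong not (sym (isRow-old T b c k))) ic) in old r , one-old⁺ o
    ... | new with b≡f ← ¬true⇒false (not-elim (trans (cong not (sym (isRow-new T b c))) ic)) | nonEmpty b≡f
    ...   | inj₁ d       = neg (fromℕ n) , one-corner⁺ b≡f d
    ...   | inj₂ (r , e) = old r , one-new⁺ (Free.isPresent (proj₂ (onFree r e))) b≡f e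
    noElbow′ : ∀ r {k r′ k′} → Zero T′ r k → Above r′ r → One T′ r′ k → LeftOf k′ k → ¬ One T′ r k′
    noElbow′ r {k} {r′} {k′} z a o l o′ with rowView r | colView k
    ... | newNeg  | isOld k = ¬cell-newNeg {T = T} {b} {c} (zero⇒isCell z)
    ... | newPos  | _       = ¬cell-newPos {T = T} {b} {c} (zero⇒isCell z)
    ... | _       | new     = ¬leftOf-new l
    ... | isOld r | isOld k with rowView r′ | colView k′
    ...   | newNeg  | _       = ¬cell-newNeg {T = T} {b} {c} (one⇒isCell o)
    ...   | newPos  | _       = ¬cell-newPos {T = T} {b} {c} (one⇒isCell o)
    ...   | isOld _ | isOld _ = noElbow (zero-old⁻ z) (above-old⁻ a) (one-old⁻ o) (leftOf-old⁻ l) (one-old⁻ o′)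
    -- The 1 on the left is new, so its row is free and has no 0 below a 1.
    ...   | isOld _ | new     =
      Free.noAbove (proj₂ (onFree r (one-new⁻ {T = T} o′))) (zero-old⁻ z) (above-old⁻ a) (one-old⁻ o)
    noDiagonal′ : ∀ r {k k′} → Zero T′ r k → Diagonal r k → LeftOf k′ k → ¬ One T′ r k′
    noDiagonal′ r {k} {k′} z d l o′ with rowView r | colView k
    ... | newNeg  | isOld k = ¬cell-newNeg {T = T} {b} {c} (zero⇒isCell z)
    ... | newPos  | _       = ¬cell-newPos {T = T} {b} {c} (zero⇒isCell z)
    ... | _       | new     = ¬leftOf-new l
    ... | isOld r | isOld k with colView k′
    ...   | isOld _ = noDiagonal (zero-old⁻ z) (diagonal-old⁻ d) (leftOf-old⁻ l) (one-old⁻ o′)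
    ...   | new     = Free.noDiag (proj₂ (onFree r (one-new⁻ {T = T} o′))) (zero-old⁻ z) (diagonal-old⁻ d)

-- Unrestricted labels of an extension

module _ {T : Filling n} {b : Bool} {c : Column n} where
  private
    T′ = ext T b c

  RowUnrestricted-old⁻ : ∀ {r} → RowUnrestricted T′ (old r) → RowUnrestricted T r
  RowUnrestricted-old⁻ (mkRowUnrestricted u) = mkRowUnrestricted λ z ¬d a o →
    u (zero-old⁺ z) (¬d ∘ diagonal-old⁻) (above-old⁺ a) (one-old⁺ o)

  -- Neither new row has a cell in an old column, so the old cells of a row gain no 1 above them.
  -- Only its cell in the new column remains to be checked.
  RowUnrestricted-old⁺ : ∀ {r} → RowUnrestricted T r →
    (∀ {r′} → Zero T′ (old r) (fromℕ n) → Above r′ (old r) → ¬ One T′ r′ (fromℕ n)) →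
    RowUnrestricted T′ (old r)
  RowUnrestricted-old⁺ {r} (mkRowUnrestricted u) h = mkRowUnrestricted go
    where
    go : ∀ {k r′} → Zero T′ (old r) k → ¬ Diagonal (old r) k → Above r′ (old r) → ¬ One T′ r′ k
    go {k} {r′} z ¬d a o with colView k | rowView r′
    ... | new     | _       = h z a o
    ... | isOld k | isOld _ = u (zero-old⁻ z) (¬d ∘ diagonal-old⁺) (above-old⁻ a) (one-old⁻ o)
    ... | isOld k | newNeg  = ¬cell-newNeg {T = T} {b} {c} (one⇒isCell o)
    ... | isOld k | newPos  = ¬cell-newPos {T = T} {b} {c} (one⇒isCell o)

  ColUnrestricted-old⁻ : ∀ {k} → ColUnrestricted T′ (inject₁ k) → ColUnrestricted T k
  ColUnrestricted-old⁻ (mkColUnrestricted u) = mkColUnrestricted λ z l o →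
    u (zero-old⁺ z) (leftOf-old⁺ l) (one-old⁺ o)

  ColUnrestricted-old⁺ : ∀ {k} → ColUnrestricted T k →
    (∀ {r} → Zero T r k → ¬ One T′ (old r) (fromℕ n)) → ColUnrestricted T′ (inject₁ k)
  ColUnrestricted-old⁺ {k} (mkColUnrestricted u) h = mkColUnrestricted go
    where
    go : ∀ {r k′} → Zero T′ r (inject₁ k) → LeftOf k′ (inject₁ k) → ¬ One T′ r k′
    go {r} {k′} z l o with rowView r | colView k′
    ... | isOld _ | isOld _ = u (zero-old⁻ z) (leftOf-old⁻ l) (one-old⁻ o)
    ... | isOld _ | new     = h (zero-old⁻ z) o
    ... | newNeg  | _       = ¬cell-newNeg {T = T} {b} {c} (zero⇒isCell z)
    ... | newPos  | _       = ¬cell-newPos {T = T} {b} {c} (zero⇒isCell z)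

  inUR-old : (∀ r → ¬ One T′ r (fromℕ n)) → ∀ ℓ → inUR T′ (inject₁ ℓ) ≡ inUR T ℓ
  inUR-old empty ℓ = bool-ext (inUR-intro ∘ down ∘ inUR-elim) (inUR-intro ∘ up ∘ inUR-elim)
    where
    down : UR T′ (inject₁ ℓ) → UR T ℓ
    down (viaRow {k} ir u o) with colView k
    ... | isOld _ = viaRow (trans (sym (isRow-old T b c ℓ)) ir) (RowUnrestricted-old⁻ u) (one-old⁻ o)
    ... | new     = ⊥-elim (empty _ o)
    down (viaCol ic u u′) =
      viaCol (trans (cong not (sym (isRow-old T b c ℓ))) ic) (ColUnrestricted-old⁻ u) (RowUnrestricted-old⁻ u′)
    up : UR T ℓ → UR T′ (inject₁ ℓ)
    up (viaRow ir u o) =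
      viaRow (trans (isRow-old T b c ℓ) ir) (RowUnrestricted-old⁺ u λ _ _ → empty _) (one-old⁺ o)
    up (viaCol ic u u′) = viaCol (trans (cong not (isRow-old T b c ℓ)) ic)
      (ColUnrestricted-old⁺ u λ _ → empty _) (RowUnrestricted-old⁺ u′ λ _ _ → empty _)

  -- A new row has no cells, hence no 1. A new column has nothing to its left, and its diagonal row
  -- is the topmost one, so neither kind of restriction can occur.
  inUR-new : inUR T′ (fromℕ n) ≡ not b
  inUR-new = bool-ext (down ∘ inUR-elim) (inUR-intro ∘ up)
    where
    down : UR T′ (fromℕ n) → not b ≡ true
    down (viaRow _ _ o)  = ⊥-elim (¬cell-newPos {T = T} {b} {c} (one⇒isCell o))
    down (viaCol ic _ _) = trans (cong not (sym (isRow-new T b c))) ic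
    newRow : ∀ {k r′} → Zero T′ (neg (fromℕ n)) k → ¬ Diagonal (neg (fromℕ n)) k → Above r′ (neg (fromℕ n)) → ¬ One T′ r′ k
    newRow _ _ a _ = ¬above-newNeg a
    up : not b ≡ true → UR T′ (fromℕ n)
    up nb = viaCol (trans (cong not (isRow-new T b c)) nb)
      (mkColUnrestricted λ _ l _ → ¬leftOf-new l) (mkRowUnrestricted newRow)

  -- In a positive row the new 1 is the 1 that is required. In a negative row -j, column j has to be
  -- unrestricted as well: a free row has no diagonal 0, so its diagonal cell holds a 1, which
  -- settles the column.
  Free⇒inUR : ∀ {r} → Free T r → b ≡ false → c ! r ≡ true → Valid T′ → inUR T′ (label (old r)) ≡ true
  Free⇒inUR {r} f b≡f e v = inUR-intro (go r f e unrestricted)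
    where
    unrestricted : RowUnrestricted T′ (old r)
    unrestricted = RowUnrestricted-old⁺ (Free⇒RowUnrestricted f) λ z _ _ → true≢false e (zero-new⁻ {T = T} z)
    go : ∀ r → Free T r → c ! r ≡ true → RowUnrestricted T′ (old r) → UR T′ (label (old r))
    go (pos i) f e u = viaRow (Present.holds (present-old⁺ {T = T} {b} {c} (Free.isPresent f))) u (one-new⁺ (Free.isPresent f) b≡f e)
    go (neg j) f e u = viaCol (Present.holds (present-old⁺ {T = T} {b} {c} (Free.isPresent f)))
      (diagonal-one⇒ColUnrestricted v (one-old⁺ (¬zero⇒one cell λ z → Free.noDiag f z (diagonal (≡ᵇ-intro (toℕ j)))))) u
      where
      isC : isCol (Filling.shape T) j ≡ true
      isC = Present.holds (Free.isPresent f)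
      cell : isCell (Filling.shape T) (neg j) j ≡ true
      cell = ∧-intro isC (∧-intro isC (≤ᵇ-intro (ℕ.≤-refl {toℕ j})))

  restricted⇒¬inUR : ∀ {r} → Present (Filling.shape T) r → ¬ RowUnrestricted T′ (old r) →
                     inUR T′ (label (old r)) ≡ false
  restricted⇒¬inUR {r} p ¬u = ¬true⇒false (go r p ¬u ∘ inUR-elim)
    where
    go : ∀ r → Present (Filling.shape T) r → ¬ RowUnrestricted T′ (old r) → ¬ UR T′ (label (old r))
    go (pos i) p ¬u (viaRow _ u _)  = ¬u u
    go (pos i) p ¬u (viaCol ic _ _) = not-elim ic (Present.holds (present-old⁺ {T = T} {b} {c} p))
    go (neg j) p ¬u (viaRow ir _ _) = not-elim (Present.holds (present-old⁺ {T = T} {b} {c} p)) ir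
    go (neg j) p ¬u (viaCol _ _ u)  = ¬u u

-- Sums over the entries of a new column

∑Column : (Column n → ℤ) → ℤ
∑Column {n} f = ∑ (allVecs bools n) λ p → ∑ (allVecs bools n) λ q → ∑ bools λ d → f (mkColumn p q d)

∑Column-only : (c₀ : Column n) (f : Column n → ℤ) →
  (∀ c r → c ! r ≢ c₀ ! r → f c ≡ + 0) → (∀ c → corner c ≢ corner c₀ → f c ≡ + 0) → ∑Column f ≡ f c₀
∑Column-only {n} (mkColumn p q d) f z z′ = begin
  ∑ V (λ p → ∑ V (λ q → ∑ bools (λ d → f (mkColumn p q d))))
    ≡⟨ ∑-only p _ (λ p i ne → ∑-zero V (λ q → ∑-zero bools (λ d → z (mkColumn p q d) (pos i) ne))) ⟩
  ∑ V (λ q → ∑ bools (λ d → f (mkColumn p q d)))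
    ≡⟨ ∑-only q _ (λ q j ne → ∑-zero bools (λ d → z (mkColumn p q d) (neg j) ne)) ⟩
  ∑ bools (λ d → f (mkColumn p q d))
    ≡⟨ ∑-bools-only d _ (λ d ne → z′ (mkColumn p q d) ne) ⟩
  f (mkColumn p q d) ∎
  where V = allVecs bools n

∑Column-pair : (r : RowLab n) (f : Column n → ℤ) →
  ∑Column f ≡ ∑Column (λ c → if c ! r then f c +ℤ f (set r false c) else + 0)
∑Column-pair {n} (pos i) f =
  trans (∑-pair i λ p → ∑ V λ q → ∑ bools λ d → f (mkColumn p q d))
  (∑-cong V λ p → trans
    (∑-if (lookup p i) V (λ q → ∑ bools λ d → f (mkColumn p q d)) (λ q → ∑ bools λ d → f (mkColumn (p [ i ]≔ false) q d)))
    (∑-cong V λ q → ∑-if (lookup p i) bools (λ d → f (mkColumn p q d)) (λ d → f (mkColumn (p [ i ]≔ false) q d))))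
  where V = allVecs bools n
∑Column-pair {n} (neg j) f = ∑-cong V λ p →
  trans (∑-pair j λ q → ∑ bools λ d → f (mkColumn p q d))
  (∑-cong V λ q → ∑-if (lookup q j) bools (λ d → f (mkColumn p q d)) (λ d → f (mkColumn p (q [ j ]≔ false) d)))
  where V = allVecs bools n

-- Cancellation of columns

label-old : (r : RowLab n) → label (old r) ≡ inject₁ (label r)
label-old (neg j) = refl
label-old (pos i) = refl

module _ {T : Filling n} {r : RowLab n} (pv : Pivot T r) where
  open Pivot pv

  private
    add : Column n → Filling (suc n)
    add = ext T false

    Agree : Column n → Column n → Set
    Agree c c′ = (∀ r′ → r′ ≢ r → c ! r′ ≡ c′ ! r′) × corner c ≡ corner c′

    agree-set : ∀ b c → Agree c (set r b c)
    agree-set b c = (λ r′ r′≢r → sym (set-other r b c r′≢r)) , sym (set-corner r b c)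

    agree-sym : ∀ {c c′} → Agree c c′ → Agree c′ c
    agree-sym (e , e′) = (λ r′ r′≢r → sym (e r′ r′≢r)) , sym e′

    one-agree : ∀ {c c′ r′} → Agree c c′ → r′ ≢ r → One (add c′) (old r′) (fromℕ n) → One (add c) (old r′) (fromℕ n)
    one-agree {c} {c′} (e , _) r′≢r o = one-new⁺ (cell-new-present {T = T} {false} {c′} (one⇒isCell o)) refl
      (trans (e _ r′≢r) (one-new⁻ {T = T} o))

    zero-agree : ∀ {c c′ r′} → Agree c c′ → r′ ≢ r → Zero (add c′) (old r′) (fromℕ n) → Zero (add c) (old r′) (fromℕ n)
    zero-agree {c} {c′} (e , _) r′≢r z = zero-new⁺ (cell-new-present {T = T} {false} {c′} (zero⇒isCell z)) refl
      (trans (e _ r′≢r) (zero-new⁻ {T = T} z))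

    row-agree : ∀ {c c′ r′} → Agree c c′ → r′ ≢ r →
                RowUnrestricted (add c) (old r′) → RowUnrestricted (add c′) (old r′)
    row-agree {c} {c′} {r′} a r′≢r u = RowUnrestricted-old⁺ (RowUnrestricted-old⁻ u) λ {r″} → go r″
      where
      go : ∀ r″ → Zero (add c′) (old r′) (fromℕ n) → Above r″ (old r′) → ¬ One (add c′) r″ (fromℕ n)
      go r″ z ab o with rowView r″
      ... | newNeg = RowUnrestricted.noAbove u (zero-agree a r′≢r z) (¬diagonal-new {r = r′}) ab
        (one-corner⁺ refl (trans (proj₂ a) (one-corner⁻ {T = T} o)))
      ... | newPos = ¬newPos-above ab
      ... | isOld r″ with r″ ≟ᴿ r
      -- The only dangerous case: the 1 above `r′` is in the toggled row. Then `r′` lies below the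
      -- pivot and is restricted in `T` already.
      ...   | yes refl = lowest (above-old⁻ ab) (cell-new-present {T = T} {false} {c′} (zero⇒isCell z)) (RowUnrestricted-old⁻ u)
      ...   | no r″≢r  = RowUnrestricted.noAbove u (zero-agree a r′≢r z) (¬diagonal-new {r = r′}) ab (one-agree a r″≢r o)

    col-agree : ∀ {c c′ k} → Agree c c′ →
                ColUnrestricted (add c) (inject₁ k) → ColUnrestricted (add c′) (inject₁ k)
    col-agree {c} {c′} {k} a u = ColUnrestricted-old⁺ (ColUnrestricted-old⁻ u) λ {r′} → go r′
      where
      go : ∀ r′ → Zero T r′ k → ¬ One (add c′) (old r′) (fromℕ n)
      go r′ z o with r′ ≟ᴿ r
      ... | no r′≢r  = ColUnrestricted.noLeft u (zero-old⁺ z) new-leftOf (one-agree a r′≢r o)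
      -- A new 1 in row `r` does no harm here: the 0 in column `k` has a 1 of `T` to its left, so
      -- the column was restricted before.
      ... | yes refl = let _ , l , o′ = saturated z in
        ColUnrestricted.noLeft u (zero-old⁺ z) (leftOf-old⁺ l) (one-old⁺ o′)

    UR-agree : ∀ {c c′ ℓ} → Agree c c′ → ℓ ≢ label r → UR (add c) (inject₁ ℓ) → UR (add c′) (inject₁ ℓ)
    UR-agree {c} {c′} {ℓ} a ℓ≢r (viaRow {k} ir u o) = viaRow
      (trans (isRow-old T false c′ ℓ) (trans (sym (isRow-old T false c ℓ)) ir))
      (row-agree a (ℓ≢r ∘ cong label) u) (go k o .proj₂)
      where
      go : ∀ k → One (add c) (pos (inject₁ ℓ)) k → ∃ λ k → One (add c′) (pos (inject₁ ℓ)) k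
      go k o with colView k
      ... | isOld _ = _ , one-old⁺ {T = T} {false} {c′} {pos ℓ} (one-old⁻ o)
      ... | new     = _ , one-agree (agree-sym {c} {c′} a) (ℓ≢r ∘ cong label) o
    UR-agree {c} {c′} {ℓ} a ℓ≢r (viaCol ic u u′) = viaCol
      (trans (cong not (isRow-old T false c′ ℓ)) (trans (sym (cong not (isRow-old T false c ℓ))) ic))
      (col-agree a u) (row-agree a (ℓ≢r ∘ cong label) u′)

    inUR-agree : ∀ {c c′} → Agree c c′ → ∀ ℓ → ℓ ≢ label r → inUR (add c) (inject₁ ℓ) ≡ inUR (add c′) (inject₁ ℓ)
    inUR-agree {c} {c′} a ℓ ℓ≢r = bool-ext (inUR-intro ∘ UR-agree a ℓ≢r ∘ inUR-elim)
      (inUR-intro ∘ UR-agree (agree-sym {c} {c′} a) ℓ≢r ∘ inUR-elim)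

    -- The minus sign is the contribution of the new column, whose label is always unrestricted.
    weight-add : ∀ c → Valid (add c) → weight (add c) ≡ - sgn n (inUR (add c) ∘ inject₁)
    weight-add c v = trans (weight-valid (add c) v) (trans (sgn-last (inUR (add c)))
      (cong (λ b → (if b then -_ else id) (sgn n (inUR (add c) ∘ inject₁))) (inUR-new {T = T})))

    inUR-pivot : ∀ c → c ! r ≡ true → Valid (add c) → inUR (add c) (inject₁ (label r)) ≡ true
    inUR-pivot c e v = subst (λ ℓ → inUR (add c) ℓ ≡ true) (label-old r) (Free⇒inUR {c = c} free refl e v)

    Other : Column n → Set
    Other c = corner c ≡ true ⊎ ∃ λ r′ → r′ ≢ r × c ! r′ ≡ true

    -- A 1 outside row `r` is either in the diagonal cell, whose row is topmost, or in a free row. A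
    -- free row is unrestricted and therefore cannot lie below the pivot.
    other-above : ∀ c → Valid (add c) → Other c → ∃ λ r′ → Above r′ (old r) × One (add c) r′ (fromℕ n)
    other-above c v (inj₁ d) = _ , newNeg-above r , one-corner⁺ refl d
    other-above c v (inj₂ (r′ , r′≢r , e)) with
      _ , f ← Extendable.onFree (Valid⇒Extendable T false c v) r′ e | Above-connex r′≢r
    ... | inj₁ a = _ , above-old⁺ a , one-new⁺ (Free.isPresent f) refl e
    ... | inj₂ a = ⊥-elim (lowest a (Free.isPresent f) (Free⇒RowUnrestricted f))

    inUR-restricted : ∀ c → c ! r ≡ false → Valid (add c) → Other c → inUR (add c) (inject₁ (label r)) ≡ false
    inUR-restricted c e v other = subst (λ ℓ → inUR (add c) ℓ ≡ false) (label-old r)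
      (restricted⇒¬inUR {T = T} {false} {c} (Free.isPresent free) λ u →
        let _ , a , o = other-above c v other
        in RowUnrestricted.noAbove u (zero-new⁺ (Free.isPresent free) refl e) (¬diagonal-new {r = r}) a o)

    other-agree : ∀ {c c′} → Agree c c′ → Other c → Other c′
    other-agree (e , e′) (inj₁ d)              = inj₁ (trans (sym e′) d)
    other-agree (e , e′) (inj₂ (r′ , r′≢r , o)) = inj₂ (r′ , r′≢r , trans (sym (e r′ r′≢r)) o)

    -- Row `r` is free, so both values are allowed there, and `Other` keeps the column non-empty in
    -- either case.
    extendable-agree : ∀ {c c′} → Agree c c′ → Other c → Extendable T false c → Extendable T false c′
    extendable-agree {c} {c′} a other x = record
      { base     = base
      ; onFree   = onFree′
      ; cornerOk = λ _ → refl
      ; nonEmpty = λ _ → nonEmpty′ (other-agree {c} {c′} a other)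
      }
      where
      open Extendable x
      onFree′ : ∀ r′ → c′ ! r′ ≡ true → false ≡ false × Free T r′
      onFree′ r′ e with r′ ≟ᴿ r
      ... | yes refl = refl , free
      ... | no r′≢r  = onFree r′ (trans (proj₁ a r′ r′≢r) e)
      nonEmpty′ : Other c′ → corner c′ ≡ true ⊎ ∃ λ r → c′ ! r ≡ true
      nonEmpty′ (inj₁ d)            = inj₁ d
      nonEmpty′ (inj₂ (r′ , _ , e)) = inj₂ (r′ , e)

    valid-agree : ∀ {c c′} → Agree c c′ → Other c → Valid (add c) → Valid (add c′)
    valid-agree {c} {c′} a other = Extendable⇒Valid T false c′ ∘ extendable-agree a other ∘ Valid⇒Extendable T false c

    cancel : ∀ c → c ! r ≡ true → Other c → weight (add c) +ℤ weight (add (set r false c)) ≡ + 0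
    cancel c e other = go (valid? {T = add c})
      where
      c′ = set r false c
      a : Agree c c′
      a = agree-set false c
      go : Dec (Valid (add c)) → weight (add c) +ℤ weight (add c′) ≡ + 0
      go (no ¬v) = cong₂ _+ℤ_ (weight-invalid (add c) ¬v)
        (weight-invalid (add c′) (¬v ∘ valid-agree {c′} {c} (agree-sym {c} {c′} a) (other-agree {c} {c′} a other)))
      go (yes v) = begin
        weight (add c) +ℤ weight (add c′) ≡⟨ cong₂ _+ℤ_ (weight-add c v) (weight-add c′ v′) ⟩
        - x +ℤ - y                        ≡⟨ cong (λ z → - z +ℤ - y) flip ⟩
        - - y +ℤ - y                      ≡⟨ cong (_+ℤ - y) (ℤ.neg-involutive y) ⟩
        y +ℤ - y                          ≡⟨ ℤ.+-inverseʳ y ⟩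
        + 0                               ∎
        where
        v′ = valid-agree {c} {c′} a other v
        x = sgn n (inUR (add c) ∘ inject₁)
        y = sgn n (inUR (add c′) ∘ inject₁)
        flip : x ≡ - y
        flip = sgn-flip (label r) (inUR-agree {c} {c′} a) (trans (inUR-pivot c e v)
          (sym (cong not (inUR-restricted c′ (set-same r false c) v′ (other-agree {c} {c′} a other)))))

    single : Column n
    single = set r true zeros

    no-ones : ∀ {r′} → ¬ One (add zeros) r′ (fromℕ n)
    no-ones {r′} o with rowView r′
    ... | isOld r′ = true≢false (one-new⁻ {T = T} o) (zeros-! r′)
    ... | newNeg   = true≢false (one-corner⁻ {T = T} o) refl
    ... | newPos   = ¬cell-newPos {T = T} {false} {zeros} (one⇒isCell o)

    single-valid : Valid T → Valid (add single)
    single-valid v = Extendable⇒Valid T false single record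
      { base     = v
      ; onFree   = onFree′
      ; cornerOk = λ _ → refl
      ; nonEmpty = λ _ → inj₂ (r , set-same r true zeros)
      }
      where
      onFree′ : ∀ r′ → single ! r′ ≡ true → false ≡ false × Free T r′
      onFree′ r′ e with r′ ≟ᴿ r
      ... | yes refl = refl , free
      ... | no r′≢r  = ⊥-elim (true≢false e (trans (set-other r true zeros r′≢r) (zeros-! r′)))

    -- The comparison is with `add zeros`. That filling is invalid, but the agreement of
    -- unrestricted labels needs no validity, and on old labels it has exactly those of `T`. In
    -- `add single` the label of `r` is unrestricted, so it costs a sign precisely when it was
    -- restricted in `T`; the new column costs another one.
    weight-single : weight (add single) ≡ (if inUR T (label r) then - weight T else weight T)
    weight-single = go (valid? {T = T})
      where
      a : Agree single zeros
      a = agree-sym {zeros} {single} (agree-set true zeros)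
      others : ∀ ℓ → ℓ ≢ label r → inUR (add single) (inject₁ ℓ) ≡ inUR T ℓ
      others ℓ ℓ≢r = trans (inUR-agree {single} {zeros} a ℓ ℓ≢r) (inUR-old {T = T} (λ _ → no-ones) ℓ)
      go : Dec (Valid T) → weight (add single) ≡ (if inUR T (label r) then - weight T else weight T)
      go (no ¬v) rewrite weight-invalid T ¬v
                       | weight-invalid (add single) (¬v ∘ Extendable.base ∘ Valid⇒Extendable T false single)
        with inUR T (label r)
      ... | true  = refl
      ... | false = refl
      go (yes v) rewrite weight-valid T v | weight-add single (single-valid v) with inUR T (label r) in eq
      ... | true  = cong -_ (sgn-cong same)
        where
        same : ∀ ℓ → inUR (add single) (inject₁ ℓ) ≡ inUR T ℓ
        same ℓ with ℓ Fin.≟ label r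
        ... | no ℓ≢r   = others ℓ ℓ≢r
        ... | yes refl = trans (inUR-pivot single (set-same r true zeros) (single-valid v)) (sym eq)
      ... | false = trans (cong -_ (sgn-flip (label r) others
          (trans (inUR-pivot single (set-same r true zeros) (single-valid v)) (sym (cong not eq)))))
        (ℤ.neg-involutive _)

  ∑Column-pivot : ∑Column (weight ∘ ext T false) ≡ (if inUR T (label r) then - weight T else weight T)
  ∑Column-pivot = begin
    ∑Column f                                             ≡⟨ ∑Column-pair r f ⟩
    ∑Column g                                             ≡⟨ ∑Column-only single g vanish vanish′ ⟩
    g single                                              ≡⟨ at-single ⟩
    f single                                              ≡⟨ weight-single ⟩
    (if inUR T (label r) then - weight T else weight T)   ∎
    where
    f = weight ∘ add
    g : Column n → ℤ
    g c = if c ! r then f c +ℤ f (set r false c) else + 0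
    cancel′ : ∀ c → (c ! r ≡ true → Other c) → g c ≡ + 0
    cancel′ c h with c ! r in eq
    ... | true  = cancel c eq (h refl)
    ... | false = refl
    vanish : ∀ c r′ → c ! r′ ≢ single ! r′ → g c ≡ + 0
    vanish c r′ ne = cancel′ c other
      where
      other : c ! r ≡ true → Other c
      other e with r′ ≟ᴿ r
      ... | yes refl = ⊥-elim (ne (trans e (sym (set-same r true zeros))))
      ... | no r′≢r with c ! r′ in eq
      ...   | true  = inj₂ (r′ , r′≢r , eq)
      ...   | false = ⊥-elim (ne (sym (trans (set-other r true zeros r′≢r) (zeros-! r′))))
    vanish′ : ∀ c → corner c ≢ corner single → g c ≡ + 0
    vanish′ c ne = cancel′ c λ _ → inj₁ (other (corner c) ne)
      where
      other : ∀ d → d ≢ corner single → d ≡ true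
      other true  _  = refl
      other false ne = ⊥-elim (ne (sym (set-corner r true zeros)))
    empty-invalid : ¬ Valid (add (set r false single))
    empty-invalid v with Extendable.nonEmpty (Valid⇒Extendable T false (set r false single) v) refl
    ... | inj₁ d = true≢false d (trans (set-corner r false single) (set-corner r true zeros))
    ... | inj₂ (r′ , e) with r′ ≟ᴿ r
    ...   | yes refl = true≢false e (set-same r false single)
    ...   | no r′≢r  = true≢false e
      (trans (set-other r false single r′≢r) (trans (set-other r true zeros r′≢r) (zeros-! r′)))
    at-single : g single ≡ f single
    -- The partner of `single` is the empty column, which condition (1) excludes.
    at-single rewrite set-same r true zeros | weight-invalid (add (set r false single)) empty-invalid = ℤ.+-identityʳ (f single)

-- Pivots for both kinds of last label

first-true : (p : Fin n → Bool) →
  (∃ λ i → p i ≡ true × (∀ k → toℕ k < toℕ i → p k ≡ false)) ⊎ (∀ i → p i ≡ false)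
first-true {zero}  p = inj₂ λ ()
first-true {suc n} p with p zero in eq | first-true (p ∘ suc)
... | true  | _                = inj₁ (zero , eq , λ _ ())
... | false | inj₁ (i , t , m) = inj₁ (suc i , t , λ { zero _ → eq ; (suc k) k<i → m k (ℕ.≤-pred k<i) })
... | false | inj₂ none        = inj₂ λ { zero → eq ; (suc k) → none k }

last-true : (p : Fin n → Bool) →
  (∃ λ i → p i ≡ true × (∀ k → toℕ i < toℕ k → p k ≡ false)) ⊎ (∀ i → p i ≡ false)
last-true {zero}  p = inj₂ λ ()
last-true {suc n} p with p zero in eq | last-true (p ∘ suc)
... | _     | inj₁ (i , t , m) = inj₁ (suc i , t , λ { zero () ; (suc k) i<k → m k (ℕ.≤-pred i<k) })
... | true  | inj₂ none        = inj₁ (zero , eq , λ { zero () ; (suc k) _ → none k })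
... | false | inj₂ none        = inj₂ λ { zero → eq ; (suc k) → none k }

-- From bottom to top the positive rows come first, by decreasing label, and then the negative rows,
-- by increasing j. Hence `last-true` serves the former and `first-true` the latter.
lowest-true : (p : RowLab n → Bool) → (∃ λ r → p r ≡ true) →
  ∃ λ r → p r ≡ true × (∀ {r′} → Above r r′ → p r′ ≡ false)
lowest-true p (r , t) with last-true (p ∘ pos) | first-true (p ∘ neg)
... | inj₁ (i , t , m) | _ = pos i , t , λ { {neg _} (above ()) ; {pos k} (above a) → m k (<ᵇ-elim a) }
... | inj₂ none | inj₁ (j , t , m) = neg j , t , λ { {neg k} (above a) → m k (<ᵇ-elim a) ; {pos k} _ → none k }
lowest-true p (neg j , t) | inj₂ none | inj₂ none′ = ⊥-elim (true≢false t (none′ j))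
lowest-true p (pos i , t) | inj₂ none | inj₂ none′ = ⊥-elim (true≢false t (none i))

-- The new row is at the bottom and has no cells, so every requirement holds vacuously.
Pivot-row : (T : Filling n) → Pivot (ext T true zeros) (pos (fromℕ n))
Pivot-row {n} T = record
  { free = record
    { isPresent = mkPresent (isRow-new T true zeros)
    ; noDiag    = λ z _ → noCell z
    ; noAbove   = λ z _ _ → noCell z
    }
  ; lowest    = λ a _ _ → ¬newPos-above a
  ; saturated = λ z → ⊥-elim (noCell z)
  }
  where
  noCell : ∀ {k} → ¬ Zero (ext T true zeros) (pos (fromℕ n)) k
  noCell z = ¬cell-newPos {T = T} {true} {zeros} (zero⇒isCell z)

cell-present : ∀ {T : Filling n} r {k} → isCell (Filling.shape T) r k ≡ true → Present (Filling.shape T) r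
cell-present (neg j) h = mkPresent (proj₁ (∧-elim h))
cell-present (pos i) h = mkPresent (proj₁ (∧-elim h))

module _ {T : Filling n} {c : Column n} (v : Valid (ext T false c)) where
  private
    T′ = ext T false c
  open Extendable (Valid⇒Extendable T false c v)

  -- The last column is leftmost, so its 1 in row `r` stands to the left of every 0 of that row. Row
  -- `r` was free before or is the new diagonal row. Each present row below has in this column a 0
  -- under that 1, which restricts it.
  Pivot-col : ∀ {r} → One T′ r (fromℕ n) → (∀ {r′} → Above r r′ → ¬ One T′ r′ (fromℕ n)) → Pivot T′ r
  Pivot-col {r} o low = record
    { free = record
      { isPresent = cell-present {T = T′} r (one⇒isCell o)
      ; noDiag    = λ {k} → noDiag′ k
      ; noAbove   = λ {k} → noAbove′ k
      }
    ; lowest    = λ {r′} → lowest′ r′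
    ; saturated = λ {k} → saturated′ k
    }
    where
    noDiag′ : ∀ k → Zero T′ r k → ¬ Diagonal r k
    noDiag′ k z d with rowView r | colView k
    ... | _       | new     = one-zero-disjoint o z
    ... | isOld r | isOld k = Free.noDiag (proj₂ (onFree r (one-new⁻ {T = T} o))) (zero-old⁻ z) (diagonal-old⁻ d)
    ... | newNeg  | isOld k = ¬cell-newNeg {T = T} {false} {c} (zero⇒isCell z)
    ... | newPos  | isOld k = ¬cell-newPos {T = T} {false} {c} (zero⇒isCell z)
    noAbove′ : ∀ k {r′} → Zero T′ r k → Above r′ r → ¬ One T′ r′ k
    noAbove′ k {r′} z a o′ with rowView r | colView k
    ... | _       | new     = one-zero-disjoint o z
    ... | newNeg  | isOld k = ¬cell-newNeg {T = T} {false} {c} (zero⇒isCell z)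
    ... | newPos  | isOld k = ¬cell-newPos {T = T} {false} {c} (zero⇒isCell z)
    ... | isOld r | isOld k with rowView r′
    ...   | isOld _ = Free.noAbove (proj₂ (onFree r (one-new⁻ {T = T} o))) (zero-old⁻ z) (above-old⁻ a) (one-old⁻ o′)
    ...   | newNeg  = ¬cell-newNeg {T = T} {false} {c} (one⇒isCell o′)
    ...   | newPos  = ¬cell-newPos {T = T} {false} {c} (one⇒isCell o′)
    lowest′ : ∀ r′ → Above r r′ → Present (Filling.shape T′) r′ → ¬ RowUnrestricted T′ r′
    lowest′ r′ a p u with rowView r′
    ... | newNeg = ¬above-newNeg a
    ... | newPos = true≢false (Present.holds p) (isRow-new T false c)
    ... | isOld r′ = RowUnrestricted.noAbove u (¬one⇒zero cell (low a)) (¬diagonal-new {r = r′}) a o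
      where
      cell : isCell (Filling.shape T′) (old r′) (fromℕ n) ≡ true
      cell = trans (isCell-new T false c r′) (∧-intro (Present.holds (present-old⁻ {T = T} {false} {c} p)) refl)
    saturated′ : ∀ k → Zero T′ r k → ∃ λ k′ → LeftOf k′ k × One T′ r k′
    saturated′ k z with colView k
    ... | isOld _ = _ , new-leftOf , o
    ... | new     = ⊥-elim (one-zero-disjoint o z)

  -- This fixes the sign in the pivot formula. If the 1 is in the diagonal cell, the label in
  -- question is that of the new column itself.
  one-in-new⇒inUR : ∀ {r} → One T′ r (fromℕ n) → inUR T′ (label r) ≡ true
  one-in-new⇒inUR {r} o with rowView r
  ... | isOld r = Free⇒inUR {c = c} (proj₂ (onFree r (one-new⁻ {T = T} o))) refl (one-new⁻ {T = T} o) v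
  ... | newNeg  = inUR-new {T = T}
  ... | newPos  = ⊥-elim (¬cell-newPos {T = T} {false} {c} (one⇒isCell o))

  ∑Column-afterCol-valid : ∑Column (weight ∘ ext T′ false) ≡ - weight T′
  ∑Column-afterCol-valid =
    let r , o = Valid.columnOne v (fromℕ n) (cong not (isRow-new T false c))
        r , o , low = lowest-true (λ r → one T′ r (fromℕ n)) (r , One.holds o)
    in trans (∑Column-pivot {T = T′} {r} (Pivot-col (mkOne o) λ a (mkOne o′) → true≢false o′ (low a)))
             (cong (λ b → if b then - weight T′ else weight T′) (one-in-new⇒inUR {r} (mkOne o)))

∑Column-zero : {f : Column n → ℤ} → (∀ c → f c ≡ + 0) → ∑Column f ≡ + 0
∑Column-zero {n} z = ∑-zero (allVecs bools n) λ p → ∑-zero (allVecs bools n) λ q → ∑-zero bools λ d → z (mkColumn p q d)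

ext-invalid : ∀ {T : Filling n} {b} c → ¬ Valid T → ¬ Valid (ext T b c)
ext-invalid {T = T} {b} c ¬v = ¬v ∘ Extendable.base ∘ Valid⇒Extendable T b c

∑Column-afterCol : (T : Filling n) (c : Column n) →
  ∑Column (weight ∘ ext (ext T false c) false) ≡ - weight (ext T false c)
∑Column-afterCol T c = go valid?
  where
  T′ = ext T false c
  go : Dec (Valid T′) → ∑Column (weight ∘ ext T′ false) ≡ - weight T′
  go (yes v) = ∑Column-afterCol-valid {T = T} {c} v
  go (no ¬v) = trans (∑Column-zero λ c′ → weight-invalid (ext T′ false c′) (ext-invalid {T = T′} c′ ¬v))
                     (cong -_ (sym (weight-invalid T′ ¬v)))

∑Column-afterRow : (T : Filling n) → ∑Column (weight ∘ ext (ext T true zeros) false) ≡ weight (ext T true zeros)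
∑Column-afterRow T = trans (∑Column-pivot (Pivot-row T))
  (cong (λ b → if b then - weight (ext T true zeros) else weight (ext T true zeros)) (inUR-new {T = T} {true} {zeros}))

weight-row : (T : Filling n) → weight (ext T true zeros) ≡ weight T
weight-row {n} T = go valid?
  where
  T′ = ext T true zeros
  extendable : Valid T → Extendable T true zeros
  extendable v = record
    { base     = v
    ; onFree   = λ r e → ⊥-elim (true≢false e (zeros-! r))
    ; cornerOk = λ ()
    ; nonEmpty = λ ()
    }
  empty : ∀ r → ¬ One T′ r (fromℕ n)
  empty r o with rowView r
  ... | isOld r = true≢false (one-new⁻ {T = T} o) (zeros-! r)
  ... | newNeg  = true≢false (one-corner⁻ {T = T} o) refl
  ... | newPos  = ¬cell-newPos {T = T} {true} {zeros} (one⇒isCell o)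
  go : Dec (Valid T) → weight T′ ≡ weight T
  go (no ¬v) = trans (weight-invalid T′ (ext-invalid {T = T} zeros ¬v)) (sym (weight-invalid T ¬v))
  go (yes v) = begin
    weight T′                          ≡⟨ weight-valid T′ (Extendable⇒Valid T true zeros (extendable v)) ⟩
    sgn (suc n) (inUR T′)              ≡⟨ sgn-last (inUR T′) ⟩
    (if inUR T′ (fromℕ n) then -_ else id) (sgn n (inUR T′ ∘ inject₁))
      ≡⟨ cong (λ b → (if b then -_ else id) (sgn n (inUR T′ ∘ inject₁))) (inUR-new {T = T} {true} {zeros}) ⟩
    sgn n (inUR T′ ∘ inject₁)          ≡⟨ sgn-cong (inUR-old {T = T} {true} {zeros} empty) ⟩
    sgn n (inUR T)                     ≡⟨ sym (weight-valid T v) ⟩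
    weight T                           ∎

-- Summing over fillings label by label

∑-fillings : (f : Filling n → ℤ) → ∑ (allFillings n) f ≡
  ∑ (allVecs bools n) λ s → ∑ (allVecs (allVecs bools n) n) λ P → ∑ (allVecs (allVecs bools n) n) λ N → f (mkFilling s P N)
∑-fillings {n} f =
  trans (∑-concatMap _ (allVecs bools n) f) (∑-cong (allVecs bools n) λ s →
  trans (∑-concatMap _ mats f) (∑-cong mats λ P → ∑-map (mkFilling s P) mats f))
  where mats = allVecs (allVecs bools n) n

∑-border : (f : Vec (Vec Bool (suc n)) (suc n) → ℤ) →
  ∑ (allVecs (allVecs bools (suc n)) (suc n)) f ≡
  ∑ (allVecs (allVecs bools n) n) λ M → ∑ (allVecs bools n) λ c → ∑ (allVecs bools n) λ u → ∑ bools λ d → f (border M c u d)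
∑-border {n} f =
  trans (∑-∷ʳ (allVecs bools (suc n)) n f)
  (trans (∑-addColumn n n _)
  (∑-cong (allVecs (allVecs bools n) n) λ M → ∑-cong (allVecs bools n) λ c → ∑-∷ʳ bools n λ w → f (zipWith _∷ʳ_ M c ∷ʳ w)))

VanishesOnInvalid : (Filling n → ℤ) → Set
VanishesOnInvalid f = ∀ T → ¬ Valid T → f T ≡ + 0

module _ {f : Filling (suc n) → ℤ} (vanish : VanishesOnInvalid f) where
  private
    V = allVecs bools n
    mats = allVecs V n


    outside : ∀ T r k → isCell (Filling.shape T) r k ≡ false → entry T r k ≢ false → f T ≡ + 0
    outside T r k nc ne = vanish T λ v → ne (Valid.outside v r k nc)

  ∑-addLabel-fixed : (s : Shape n) (b : Bool) →
    ∑ (allVecs (allVecs bools (suc n)) (suc n)) (λ P → ∑ (allVecs (allVecs bools (suc n)) (suc n)) λ N → f (mkFilling (s ∷ʳ b) P N)) ≡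
    ∑ mats λ P → ∑ mats λ N → ∑Column λ c → f (ext (mkFilling s P N) b c)
  ∑-addLabel-fixed s b = trans (∑-border λ P → ∑ mats′ λ N → f (F P N)) (∑-cong mats λ P → trans
    (∑-cong V λ p → begin
      ∑ V (λ u → ∑ bools λ d → ∑ mats′ λ N → f (F (border P p u d) N))
        -- Only the shape matters for `isCell-newPos`, so the second `P` in `mkFilling s P P` is a
        -- mere placeholder.
        ≡⟨ ∑-only zs _ (λ u i ne → ∑-zero bools λ d → ∑-zero mats′ λ N →
             outside (F (border P p u d) N) (pos (fromℕ n)) (inject₁ i) (isCell-newPos (mkFilling s P P) b zeros (inject₁ i))
             λ e → ne (trans (trans (sym (border-lastRow P p u d i)) e) (sym (lookup-replicate i false)))) ⟩
      ∑ bools (λ d → ∑ mats′ λ N → f (F (border P p zs d) N))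
        ≡⟨ ∑-bools-only false _ (λ d ne → ∑-zero mats′ λ N →
             outside (F (border P p zs d) N) (pos (fromℕ n)) (fromℕ n) (isCell-newPos (mkFilling s P P) b zeros (fromℕ n))
             λ e → ne (trans (sym (border-corner P p zs d)) e)) ⟩
      ∑ mats′ (λ N → f (F (border P p zs false) N))
        ≡⟨ ∑-border (λ N → f (F (border P p zs false) N)) ⟩
      ∑ mats (λ N → ∑ V λ q → ∑ V λ u → ∑ bools λ d → f (F (border P p zs false) (border N q u d)))
        ≡⟨ ∑-cong mats (λ N → ∑-cong V λ q → ∑-only zs _ λ u j ne → ∑-zero bools λ d →
             outside (F (border P p zs false) (border N q u d)) (neg (fromℕ n)) (inject₁ j) (isCell-newNeg (mkFilling s P N) b zeros j)
             λ e → ne (trans (trans (sym (border-lastRow N q u d j)) e) (sym (lookup-replicate j false)))) ⟩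
      ∑ mats (λ N → ∑ V λ q → ∑ bools λ d → f (ext (mkFilling s P N) b (mkColumn p q d))) ∎)
    (∑-swap V mats λ p N → ∑ V λ q → ∑ bools λ d → f (ext (mkFilling s P N) b (mkColumn p q d))))
    where
    mats′ = allVecs (allVecs bools (suc n)) (suc n)
    zs = replicate n false
    F = mkFilling (s ∷ʳ b)

  -- Kept general in `f` because it is used twice: for `weight`, and for the sum of the weights of
  -- the one-label extensions.
  ∑-addLabel : ∑ (allFillings (suc n)) f ≡
    ∑ (allFillings n) λ T → ∑Column (f ∘ ext T true) +ℤ ∑Column (f ∘ ext T false)
  ∑-addLabel = begin
    ∑ (allFillings (suc n)) f
      ≡⟨ ∑-fillings f ⟩
    ∑ (allVecs bools (suc n)) g
      ≡⟨ ∑-∷ʳ bools n g ⟩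
    ∑ V (λ s → ∑ bools λ b → g (s ∷ʳ b))
      ≡⟨ ∑-cong V (λ s → ∑-cong bools (∑-addLabel-fixed s)) ⟩
    ∑ V (λ s → ∑ bools λ b → ∑ mats λ P → ∑ mats λ N → h b (mkFilling s P N))
      ≡⟨ ∑-cong V (λ s → trans
           (∑-swap bools mats λ b P → ∑ mats λ N → h b (mkFilling s P N))
           (∑-cong mats λ P → ∑-swap bools mats λ b N → h b (mkFilling s P N))) ⟩
    ∑ V (λ s → ∑ mats λ P → ∑ mats λ N → ∑ bools λ b → h b (mkFilling s P N))
      ≡⟨ sym (∑-fillings λ T → ∑ bools λ b → h b T) ⟩
    ∑ (allFillings n) (λ T → ∑ bools λ b → h b T)
      ≡⟨ ∑-cong (allFillings n) (λ T → ∑-bools λ b → h b T) ⟩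
    ∑ (allFillings n) (λ T → h true T +ℤ h false T) ∎
    where
    g : Shape (suc n) → ℤ
    g s = ∑ (allVecs (allVecs bools (suc n)) (suc n)) λ P → ∑ (allVecs (allVecs bools (suc n)) (suc n)) λ N → f (mkFilling s P N)
    h : Bool → Filling n → ℤ
    h b T = ∑Column (f ∘ ext T b)

  ∑Column-row : (T : Filling n) → ∑Column (f ∘ ext T true) ≡ f (ext T true zeros)
  ∑Column-row T = ∑Column-only zeros (f ∘ ext T true)
    (λ c r ne → vanish (ext T true c) λ v → ne (trans
      (¬true⇒false λ e → true≢false refl (proj₁ (Extendable.onFree (Valid⇒Extendable T true c v) r e)))
      (sym (zeros-! r))))
    (λ c ne → vanish (ext T true c) λ v → ne
      (¬true⇒false λ e → true≢false refl (Extendable.cornerOk (Valid⇒Extendable T true c v) e)))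

-- The recurrence and its solution

sB-weight : ∀ n → sB n ≡ ∑ (allFillings n) weight
sB-weight n = ∑-filterᵇ isPTB (allFillings n) signB

sB-recurrence : ∀ n → sB (suc (suc n)) ≡ sB n +ℤ sB n
sB-recurrence n = begin
  sB (suc (suc n))
    ≡⟨ sB-weight (suc (suc n)) ⟩
  ∑ (allFillings (suc (suc n))) weight
    ≡⟨ ∑-addLabel {n = suc n} {f = weight} weight-invalid ⟩
  ∑ (allFillings (suc n)) (λ T → ∑Column (weight ∘ ext T true) +ℤ ∑Column (weight ∘ ext T false))
    ≡⟨ ∑-cong (allFillings (suc n)) (λ T → cong (_+ℤ ∑Column (weight ∘ ext T false))
         (trans (∑Column-row {f = weight} weight-invalid T) (weight-row T))) ⟩
  ∑ (allFillings (suc n)) f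
    ≡⟨ ∑-addLabel {n = n} {f = f} vanish ⟩
  ∑ (allFillings n) (λ T → ∑Column (f ∘ ext T true) +ℤ ∑Column (f ∘ ext T false))
    ≡⟨ ∑-cong (allFillings n) (λ T → cong₂ _+ℤ_ (rowPart T) (∑Column-zero (colPart T))) ⟩
  ∑ (allFillings n) (λ T → (weight T +ℤ weight T) +ℤ + 0)
    ≡⟨ ∑-cong (allFillings n) (λ T → ℤ.+-identityʳ (weight T +ℤ weight T)) ⟩
  ∑ (allFillings n) (λ T → weight T +ℤ weight T)
    ≡⟨ ∑-+ (allFillings n) weight weight ⟩
  ∑ (allFillings n) weight +ℤ ∑ (allFillings n) weight
    ≡⟨ sym (cong₂ _+ℤ_ (sB-weight n) (sB-weight n)) ⟩
  sB n +ℤ sB n ∎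
  where
  -- The total weight of the one-label extensions of `T`; the first summand accounts for the empty
  -- row.
  f : ∀ {m} → Filling m → ℤ
  f T = weight T +ℤ ∑Column (weight ∘ ext T false)
  vanish : ∀ {m} → VanishesOnInvalid (f {m})
  vanish T ¬v = cong₂ _+ℤ_ (weight-invalid T ¬v)
    (∑Column-zero λ c → weight-invalid (ext T false c) (ext-invalid {T = T} c ¬v))
  rowPart : ∀ T → ∑Column (f ∘ ext T true) ≡ weight T +ℤ weight T
  rowPart T = trans (∑Column-row {f = f} vanish T)
    (cong₂ _+ℤ_ (weight-row T) (trans (∑Column-afterRow T) (weight-row T)))
  colPart : (T : Filling n) (c : Column n) → f (ext T false c) ≡ + 0
  colPart T c = trans (cong (weight (ext T false c) +ℤ_) (∑Column-afterCol T c)) (ℤ.+-inverseʳ (weight (ext T false c)))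

theorem3p1 : ((m : ℕ) → sB (2 * m) ≡ + (2 ^ m)) × ((m : ℕ) → sB (suc (2 * m)) ≡ + 0)
theorem3p1 = even , odd
  where
  even : (m : ℕ) → sB (2 * m) ≡ + (2 ^ m)
  even zero    = refl
  even (suc m) = begin
    sB (2 * suc m)                ≡⟨ cong sB (ℕ.*-suc 2 m) ⟩
    sB (suc (suc (2 * m)))        ≡⟨ sB-recurrence (2 * m) ⟩
    sB (2 * m) +ℤ sB (2 * m)      ≡⟨ cong (λ z → z +ℤ z) (even m) ⟩
    -- `2 ^ suc m` computes to `2 ^ m + (2 ^ m + 0)`, hence the added 0.
    + (2 ^ m) +ℤ + (2 ^ m)        ≡⟨ cong (λ k → + (2 ^ m) +ℤ + k) (sym (ℕ.+-identityʳ (2 ^ m))) ⟩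
    + (2 ^ suc m)                 ∎
  odd : (m : ℕ) → sB (suc (2 * m)) ≡ + 0
  -- Length 1 has two tableaux: the empty row with sign 1, and a column whose diagonal cell holds a
  -- 1, with sign -1.
  odd zero    = refl
  odd (suc m) = begin
    sB (suc (2 * suc m))                     ≡⟨ cong (sB ∘ suc) (ℕ.*-suc 2 m) ⟩
    sB (suc (suc (suc (2 * m))))             ≡⟨ sB-recurrence (suc (2 * m)) ⟩
    sB (suc (2 * m)) +ℤ sB (suc (2 * m))     ≡⟨ cong (λ z → z +ℤ z) (odd m) ⟩
    + 0                                      ∎
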